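{- For all integers $n\ge1$, $$\mu_{\mathcal{L}(\mathcal{H}_{2n-1})}(\hat0,\hat1)=-g_n,$$ where $\hat 0$ and $\hat 1$ are the minimum and maximum elements of $\mathcal{L}(\mathcal{H}_{2n-1})$, $\mu$ is its Möbius function, and $g_n$ is the $n$-th Genocchi number.
   Context: For $n\ge 1$, the homogenized Linial arrangement $\mathcal{H}_{2n-1}$ is the set of hyperplanes $\{x_i - x_j = y_i\}$, $1 \le i < j \le n+1$, in $\mathbb{R}^{2n+1}$ with coordinates $(x_1,\dots,x_{n+1},y_1,\dots,y_n)$. Its intersection lattice $\mathcal{L}(\mathcal{H}_{2n-1})$ is the set of all intersections of subsets of these hyperplanes (the empty intersection being the whole space), ordered by reverse inclusion. A Dumont permutation on $[2m]=\{1,\dots,2m\}$ is a permutation $\sigma$ of $[2m]$ with $2i>\sigma(2i)$ and $2i-1\le\sigma(2i-1)$ for all $i=1,\dots,m$. For $n\ge1$ the Genocchi number $g_n$ is defined as the number of Dumont permutations on $[2n-2]$ (so $g_1,g_2,\ldots=1,1,3,17,155,\dots$). -}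

module Defs where

open import Data.Bool.Base using (Bool; true; false; T)
open import Data.Fin.Base as Fin using (Fin; toℕ; inject₁; finToFun)
import Data.Fin.Properties as Fin
open import Data.Integer.Base as ℤ using (ℤ; 0ℤ; 1ℤ)
open import Data.List.Base using (List; length; filter; map; foldr; allFin)
open import Data.List.Relation.Unary.All using (All)
import Data.List.Membership.Setoid as SetoidMembership
import Data.List.Relation.Unary.Unique.Setoid as SetoidUnique
open import Data.Nat.Base as ℕ using (ℕ; suc)
import Data.Nat.Properties as ℕ
open import Data.Nat.Divisibility using (_∣_; _∣?_)
open import Data.Product.Base using (_×_; _,_; ∃; ∃₂; ∃-syntax; proj₁; proj₂)
open import Data.Rational.Base as ℚ using (ℚ; 0ℚ; ½)
import Data.Rational.Properties as ℚ
open import Data.Rational.Solver using (module +-*-Solver)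
open import Data.Unit.Base using (tt)
open import Data.Vec.Functional using (Vector)
open import Function.Base using (const; id)
open import Function.Definitions using (Injective; Surjective; Bijective)
open import Level using (Level; 0ℓ; _⊔_)
open import Relation.Binary.Bundles using (Poset)
open import Relation.Binary.Definitions using (Minimum; Maximum)
import Relation.Binary.Construct.NonStrictToStrict as Strict
open import Relation.Binary.PropositionalEquality using (_≡_; refl; cong)
open import Relation.Nullary using (Dec; ¬_)
open import Relation.Nullary.Decidable using (map′; ¬?; _×-dec_; _→-dec_)
open import Relation.Unary using (Pred; Decidable; _∈_; _⊆_; _≐_)

private
  variable
    c ℓ₁ ℓ₂ p : Level

------------------------------------------------------------------------
-- Real numbers: Cauchy sequences of rationals, considered up to _≈_.

record ℝ : Set where
  constructor mkℝ
  field
    seq    : ℕ → ℚ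
    cauchy : ∀ ε → 0ℚ ℚ.< ε →
             ∃[ N ] ∀ m n → N ℕ.≤ m → N ℕ.≤ n → ℚ.∣ seq m ℚ.- seq n ∣ ℚ.< ε

open ℝ public

infix  4 _≈_
infixl 6 _-_

_≈_ : ℝ → ℝ → Set
x ≈ y = ∀ ε → 0ℚ ℚ.< ε →
        ∃[ N ] ∀ n → N ℕ.≤ n → ℚ.∣ seq x n ℚ.- seq y n ∣ ℚ.< ε

_-_ : ℝ → ℝ → ℝ
seq    (x - y) n = seq x n ℚ.- seq y n
cauchy (x - y) ε 0<ε =
  let 0<½ε   = ℚ.*-monoʳ-<-pos ½ 0<ε
      M , hx = cauchy x (½ ℚ.* ε) 0<½ε
      N , hy = cauchy y (½ ℚ.* ε) 0<½ε
  in M ℕ.⊔ N , λ m n m≥ n≥ → bound (seq x m) (seq y m) (seq x n) (seq y n)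
       (hx m n (ℕ.≤-trans (ℕ.m≤m⊔n M N) m≥) (ℕ.≤-trans (ℕ.m≤m⊔n M N) n≥))
       (hy m n (ℕ.≤-trans (ℕ.m≤n⊔m M N) m≥) (ℕ.≤-trans (ℕ.m≤n⊔m M N) n≥))
  where
  regroup : ∀ a b a′ b′ →
            (a ℚ.- b) ℚ.- (a′ ℚ.- b′) ≡ (a ℚ.- a′) ℚ.- (b ℚ.- b′)
  regroup = solve 4 (λ a b a′ b′ →
    (a :- b) :- (a′ :- b′) := (a :- a′) :- (b :- b′)) refl
    where open +-*-Solver

  halves : ½ ℚ.* ε ℚ.+ ½ ℚ.* ε ≡ ε
  halves = solve 1 (λ e → con ½ :* e :+ con ½ :* e := e) refl ε
    where open +-*-Solver

  bound : ∀ a b a′ b′ → ℚ.∣ a ℚ.- a′ ∣ ℚ.< ½ ℚ.* ε → ℚ.∣ b ℚ.- b′ ∣ ℚ.< ½ ℚ.* ε →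
          ℚ.∣ (a ℚ.- b) ℚ.- (a′ ℚ.- b′) ∣ ℚ.< ε
  bound a b a′ b′ p q = begin-strict
    ℚ.∣ (a ℚ.- b) ℚ.- (a′ ℚ.- b′) ∣      ≡⟨ cong ℚ.∣_∣ (regroup a b a′ b′) ⟩
    ℚ.∣ (a ℚ.- a′) ℚ.- (b ℚ.- b′) ∣      ≤⟨ ℚ.∣p-q∣≤∣p∣+∣q∣ (a ℚ.- a′) (b ℚ.- b′) ⟩
    ℚ.∣ a ℚ.- a′ ∣ ℚ.+ ℚ.∣ b ℚ.- b′ ∣    <⟨ ℚ.+-mono-< p q ⟩
    ½ ℚ.* ε ℚ.+ ½ ℚ.* ε                  ≡⟨ halves ⟩
    ε                                    ∎
    where open ℚ.≤-Reasoning

------------------------------------------------------------------------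
-- The Möbius function of a locally finite poset

module _ (P : Poset c ℓ₁ ℓ₂) where
  open Poset P renaming (_≈_ to _≋_)
  open SetoidMembership Eq.setoid using () renaming (_∈_ to _∈ˡ_)
  open SetoidUnique Eq.setoid using (Unique)
  open Strict _≋_ _≤_ using (_<_)

  -- The list contains each element of Q exactly once up to _≋_.
  record Enumerates (Q : Pred Carrier p) (zs : List Carrier) : Set (c ⊔ ℓ₁ ⊔ p) where
    field
      sound    : All Q zs
      complete : ∀ {z} → Q z → z ∈ˡ zs
      unique   : Unique zs

  [_,_] : Carrier → Carrier → Pred Carrier ℓ₂
  [ x , y ] z = x ≤ z × z ≤ y

  -- μ is determined on pairs x ≤ y; its values elsewhere are irrelevant.
  -- The list of each interval is part of the data, so that a poset with
  -- infinite intervals has no Möbius function.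
  record IsMöbius (μ : Carrier → Carrier → ℤ) : Set (c ⊔ ℓ₁ ⊔ ℓ₂) where
    field
      μ-cong     : ∀ {x x′ y y′} → x ≋ x′ → y ≋ y′ → μ x y ≡ μ x′ y′
      μ-diagonal : ∀ x → μ x x ≡ 1ℤ
      μ-interval : ∀ {x y} → x < y →
                   ∃[ zs ] Enumerates [ x , y ] zs ×
                           foldr ℤ._+_ 0ℤ (map (μ x) zs) ≡ 0ℤ

------------------------------------------------------------------------
-- Intersection lattices

-- For a family H of subsets of V, indexed by a finite set I.
module Intersections {V I : Set} (H : I → Pred V 0ℓ) where

  ⋂ : (I → Bool) → Pred V 0ℓ
  ⋂ S v = ∀ h → T (S h) → v ∈ H h

  -- A set S ⊆ I represents the intersection ⋂ S, and two such are equal when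
  -- their intersections are.
  lattice : Poset 0ℓ 0ℓ 0ℓ
  lattice = record
    { Carrier = I → Bool
    ; _≈_     = λ S S′ → ⋂ S ≐ ⋂ S′
    ; _≤_     = λ S S′ → ⋂ S′ ⊆ ⋂ S
    ; isPartialOrder = record
      { isPreorder = record
        { isEquivalence = record
          { refl  = id , id
          ; sym   = λ (f , g) → g , f
          ; trans = λ (f , g) (f′ , g′) → (λ v → f′ (f v)) , (λ v → g (g′ v))
          }
        ; reflexive = proj₂
        ; trans     = λ f g v → f (g v)
        }
      ; antisym = λ f g → g , f
      }
    }

  0̂ 1̂ : I → Bool
  0̂ = const false
  1̂ = const true

  0̂-minimum : Minimum (Poset._≤_ lattice) 0̂
  0̂-minimum S _ h ()

  1̂-maximum : Maximum (Poset._≤_ lattice) 1̂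
  1̂-maximum S v h _ = v h tt

------------------------------------------------------------------------
-- The homogenized Linial arrangement

-- ℝ²ⁿ⁺¹ with coordinates (x₁ … xₙ₊₁ , y₁ … yₙ); indices are shifted to start
-- at 0.
Point : ℕ → Set
Point n = Vector ℝ (suc n) × Vector ℝ n

-- Pairs i < j, where i < j ≤ n + 1 forces i ≤ n.
Pair : ℕ → Set
Pair n = ∃₂ λ (i : Fin n) (j : Fin (suc n)) → inject₁ i Fin.< j

hyperplane : ∀ {n} → Pair n → Pred (Point n) 0ℓ
hyperplane (i , j , _) (x , y) = x (inject₁ i) - x j ≈ y i

module Linial (n : ℕ) = Intersections (hyperplane {n})

------------------------------------------------------------------------
-- Genocchi numbers

module _ {k : ℕ} where

  -- The element a of [k] = {1,…,k} is represented by the a′ : Fin k with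
  -- a = suc (toℕ a′); the comparisons are unaffected by the shift.
  record IsDumont (σ : Fin k → Fin k) : Set where
    constructor mkDumont
    field
      permutation : Bijective _≡_ _≡_ σ
      even        : ∀ a → 2 ∣ suc (toℕ a) → a Fin.> σ a
      odd         : ∀ a → ¬ 2 ∣ suc (toℕ a) → a Fin.≤ σ a

  isDumont? : Decidable IsDumont
  isDumont? σ = map′ (λ (p , e , o) → mkDumont p e o)
                     (λ (mkDumont p e o) → p , e , o)
    ((injective? ×-dec surjective?) ×-dec
     Fin.all? (λ a → (2 ∣? suc (toℕ a)) →-dec (σ a Fin.<? a)) ×-dec
     Fin.all? (λ a → ¬? (2 ∣? suc (toℕ a)) →-dec (a Fin.≤? σ a)))
    where
    injective? : Dec (Injective _≡_ _≡_ σ)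
    injective? = map′ (λ f {x} {y} → f x y) (λ f x y → f)
      (Fin.all? λ x → Fin.all? λ y → (σ x Fin.≟ σ y) →-dec (x Fin.≟ y))

    surjective? : Dec (Surjective _≡_ _≡_ σ)
    surjective? = map′ (λ f y → proj₁ (f y) , λ { refl → proj₂ (f y) })
                       (λ f y → proj₁ (f y) , proj₂ (f y) refl)
      (Fin.all? λ y → Fin.any? λ x → σ x Fin.≟ y)

-- finToFun is a bijection from Fin (k ^ k) to the functions Fin k → Fin k.
#Dumont : ℕ → ℕ
#Dumont k = length (filter isDumont? (map (finToFun {k} {k}) (allFin (k ℕ.^ k))))

-- Only meaningful for n ≥ 1.
genocchi : ℕ → ℕ
genocchi n = #Dumont (2 ℕ.* n ℕ.∸ 2)

{-# OPTIONS --safe #-}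

-- In an intersection lattice, μ S S′ is the sum of (-1)^|v| over the sets v of
-- hyperplanes not containing ⋂ S for which ⋂ S ∩ ⋂ v = ⋂ S′: summing over S′
-- in an interval gives ∏ (1 - 1), over the hyperplanes h ⊉ ⋂ S with h ⊇ ⋂ S′.
-- In the coordinates x j and z i = x i - y i the homogenized Linial arrangement
-- is the graphic arrangement of the bipartite graph z i ~ x j, i < j, so that
-- μ 0̂ 1̂ is the coefficient of t in its chromatic polynomial. Colouring the
-- vertices one at a time, only the number of colours seen on one side matters,
-- and this yields - G (n - 1) 1 for the Gandhi polynomials
--   G 0 x = x,   G (j + 1) x = x² (G j (x + 1) - G j x).
-- On the other hand, Dumont permutations are counted by a permanent. Writing
-- the condition a ≤ σ a of the odd rows as 1 - [σ a < a] leaves nested rows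
-- [σ a < a] and unrestricted rows, which are filled last; the resulting signed
-- walk obeys the same recursion.

module Submission where

open import Defs
open import Data.Integer.Base using (+_; -_)
open import Data.Nat.Base using (ℕ; _≥_)
open import Data.Product.Base using (_×_; ∃)
open import Relation.Binary.PropositionalEquality using (_≡_)

open import Data.Bool.Base using (Bool; true; false; if_then_else_; T)
open import Data.Bool.Properties using (T?)
open import Data.Empty using (⊥-elim)
open import Data.Fin.Base as Fin
  using (Fin; zero; suc; toℕ; fromℕ; fromℕ<; inject₁; finToFun; combine; remQuot; _↑ˡ_; _↑ʳ_)
import Data.Fin.Properties as Fin
open import Data.Integer.Base as ℤ using (ℤ; _+_; _*_; 0ℤ; 1ℤ; -1ℤ)
import Data.Integer.Properties as ℤ
open import Data.Integer.Tactic.RingSolver using (solve-∀)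
open import Data.List.Base
  using (List; []; _∷_; _++_; map; filter; foldr; length; deduplicate; allFin; tabulate; replicate; applyUpTo)
import Data.List.Membership.DecPropositional as DecMembership
open import Data.List.Membership.Propositional using (_∈_; find)
import Data.List.Membership.Propositional.Properties as Mem
import Data.List.Membership.Setoid as SetoidMembership
import Data.List.Membership.Setoid.Properties as SMem
import Data.List.Properties as List
open import Data.List.Relation.Unary.All as All using (All; []; _∷_)
import Data.List.Relation.Unary.All.Properties as All
open import Data.List.Relation.Unary.AllPairs using ([]; _∷_)
open import Data.List.Relation.Unary.Any as Any using (here; there)
import Data.List.Relation.Unary.Any.Properties as Any
import Data.List.Relation.Unary.Unique.DecSetoid.Properties as Unique
import Data.List.Relation.Unary.Unique.Setoid as SetoidUnique
open import Data.Nat.Base as ℕ using (zero; suc; s≤s; z≤n; z<s)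
open import Data.Nat.Divisibility using (_∣_; _∣?_; _∣0; ∣m+n∣m⇒∣n; ∣m∣n⇒∣m+n; ∣-refl; ∣⇒≤)
import Data.Nat.Properties as ℕ
open import Data.Product.Base using (_,_; ∃₂; ∃-syntax; proj₁; proj₂; swap)
import Data.Product.Properties as Product
open import Data.Rational.Base as ℚ using (ℚ; 0ℚ; 1ℚ; ½)
import Data.Rational.Properties as ℚ
open import Data.Rational.Solver using (module +-*-Solver)
open import Data.Sum.Base using (_⊎_; inj₁; inj₂)
open import Function.Base using (_∘_; id; const)
open import Function.Definitions using (Injective; Surjective)
open import Level using (Level; 0ℓ)
open import Relation.Binary.Bundles using (Poset; Setoid; DecSetoid)
open import Relation.Binary.PropositionalEquality
  using (_≢_; _≗_; refl; sym; trans; cong; cong₂; subst; subst₂; setoid; module ≡-Reasoning)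
open import Relation.Nullary using (Dec; yes; no; does; ¬_; contradiction)
open import Relation.Nullary.Decidable using (map′; ¬?; _×-dec_; _⊎-dec_; _→-dec_; from-no)
open import Relation.Unary using (Pred; _≐_)
open import Algebra.Properties.Semiring.Sum ℤ.+-*-semiring
  using (sum; sum-cong-≗; ∑-distrib-+; ∑-comm; *-distribˡ-sum; *-distribʳ-sum)

-- The order of the lattice quantifies over all real points, and equality of Cauchy reals cannot be
-- decided; yet listing an interval without repetition requires deciding when some hyperplanes force
-- another. The decision is made on the graph. Either an edge set forces `f u ≈ f v` for labellings
-- in every setoid, hence in ℝ, or some labelling by two values respects the edges and separates `u`
-- from `v`; its values, read as the reals 0 and 1 for the coordinates `z` and `x`, give a point
-- refuting the implication.
--
-- The chromatic polynomial itself is never formed. `𝔼` is directly the functional "coefficient of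
-- t" on weighted colourings. It is linear and sends the indicator of "constant along the edges of
-- `v`" to 1 or 0 according to whether `v` is connected, which is exactly the condition for `v` to
-- contribute to `μ 0̂ 1̂`.
--
-- Every Möbius function brings its own lists of intervals, so the value is computed for one
-- explicit function and transferred to all others by uniqueness.

private
  variable
    ℓ₁ ℓ₂ : Level
    A B : Set ℓ₁
    Q R : Set ℓ₁
    N K k n : ℕ

-- Sums and products

𝟙 : Dec Q → ℤ
𝟙 d = if does d then 1ℤ else 0ℤ

𝟙-yes : (d : Dec Q) → Q → 𝟙 d ≡ 1ℤ
𝟙-yes (yes _) _ = refl
𝟙-yes (no ¬x) x = contradiction x ¬x

𝟙-no : (d : Dec Q) → ¬ Q → 𝟙 d ≡ 0ℤ
𝟙-no (yes x) ¬x = contradiction x ¬x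
𝟙-no (no _)  _  = refl

𝟙-cong : (d : Dec Q) (e : Dec R) → (Q → R) → (R → Q) → 𝟙 d ≡ 𝟙 e
𝟙-cong (yes x) e f g = sym (𝟙-yes e (f x))
𝟙-cong (no ¬x) e f g = sym (𝟙-no e (¬x ∘ g))

∑ᴸ ∏ᴸ : List A → (A → ℤ) → ℤ
∑ᴸ xs f = foldr _+_ 0ℤ (map f xs)
∏ᴸ xs f = foldr _*_ 1ℤ (map f xs)

∑ᴸ-cong : ∀ (xs : List A) {f g : A → ℤ} → f ≗ g → ∑ᴸ xs f ≡ ∑ᴸ xs g
∑ᴸ-cong xs f≗g = cong (foldr _+_ 0ℤ) (List.map-cong f≗g xs)

∏ᴸ-cong : ∀ (xs : List A) {f g : A → ℤ} → f ≗ g → ∏ᴸ xs f ≡ ∏ᴸ xs g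
∏ᴸ-cong xs f≗g = cong (foldr _*_ 1ℤ) (List.map-cong f≗g xs)

∏ᴸ-cong-All : ∀ {xs : List A} {f g : A → ℤ} → All (λ x → f x ≡ g x) xs → ∏ᴸ xs f ≡ ∏ᴸ xs g
∏ᴸ-cong-All []         = refl
∏ᴸ-cong-All (fx ∷ fxs) = cong₂ _*_ fx (∏ᴸ-cong-All fxs)

∑ᴸ-zero : ∀ {xs : List A} {f} → All (λ x → f x ≡ 0ℤ) xs → ∑ᴸ xs f ≡ 0ℤ
∑ᴸ-zero []         = refl
∑ᴸ-zero (fx ∷ fxs) = cong₂ _+_ fx (∑ᴸ-zero fxs)

∏ᴸ-one : ∀ {xs : List A} {f} → All (λ x → f x ≡ 1ℤ) xs → ∏ᴸ xs f ≡ 1ℤ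
∏ᴸ-one []         = refl
∏ᴸ-one (fx ∷ fxs) = cong₂ _*_ fx (∏ᴸ-one fxs)

∏ᴸ-zero : ∀ {xs : List A} {f x} → x ∈ xs → f x ≡ 0ℤ → ∏ᴸ xs f ≡ 0ℤ
∏ᴸ-zero {xs = _ ∷ xs} {f} (here refl) fx = cong (_* ∏ᴸ xs f) fx
∏ᴸ-zero {xs = y ∷ _}  {f} (there x∈)  fx =
  trans (cong (f y *_) (∏ᴸ-zero x∈ fx)) (ℤ.*-zeroʳ (f y))

∑ᴸ-++ : ∀ (xs ys : List A) f → ∑ᴸ (xs ++ ys) f ≡ ∑ᴸ xs f + ∑ᴸ ys f
∑ᴸ-++ []       ys f = sym (ℤ.+-identityˡ _)
∑ᴸ-++ (x ∷ xs) ys f = trans (cong (_+_ (f x)) (∑ᴸ-++ xs ys f)) (sym (ℤ.+-assoc (f x) _ _))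

∑ᴸ-map : ∀ (g : A → B) xs f → ∑ᴸ (map g xs) f ≡ ∑ᴸ xs (f ∘ g)
∑ᴸ-map g xs f = cong (foldr _+_ 0ℤ) (sym (List.map-∘ xs))

∏ᴸ-map : ∀ (g : A → B) xs f → ∏ᴸ (map g xs) f ≡ ∏ᴸ xs (f ∘ g)
∏ᴸ-map g xs f = cong (foldr _*_ 1ℤ) (sym (List.map-∘ xs))

∏ᴸ-++ : ∀ (xs ys : List A) f → ∏ᴸ (xs ++ ys) f ≡ ∏ᴸ xs f * ∏ᴸ ys f
∏ᴸ-++ []       ys f = sym (ℤ.*-identityˡ _)
∏ᴸ-++ (x ∷ xs) ys f = trans (cong (f x *_) (∏ᴸ-++ xs ys f)) (sym (ℤ.*-assoc (f x) _ _))

∏ᴸ-* : ∀ (xs : List A) f g → ∏ᴸ xs f * ∏ᴸ xs g ≡ ∏ᴸ xs (λ x → f x * g x)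
∏ᴸ-* []       f g = refl
∏ᴸ-* (x ∷ xs) f g = trans (interchange (f x) _ (g x) _) (cong (f x * g x *_) (∏ᴸ-* xs f g))
  where
  interchange : ∀ a b c d → (a * b) * (c * d) ≡ (a * c) * (b * d)
  interchange = solve-∀

∑ᴸ-+ : ∀ (xs : List A) f g → ∑ᴸ xs (λ x → f x + g x) ≡ ∑ᴸ xs f + ∑ᴸ xs g
∑ᴸ-+ []       f g = refl
∑ᴸ-+ (x ∷ xs) f g = trans (cong (_+_ (f x + g x)) (∑ᴸ-+ xs f g)) (interchange (f x) (g x) _ _)
  where
  interchange : ∀ a b c d → (a + b) + (c + d) ≡ (a + c) + (b + d)
  interchange = solve-∀

∑ᴸ-*ˡ : ∀ c (xs : List A) f → ∑ᴸ xs (λ x → c * f x) ≡ c * ∑ᴸ xs f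
∑ᴸ-*ˡ c []       f = sym (ℤ.*-zeroʳ c)
∑ᴸ-*ˡ c (x ∷ xs) f = trans (cong (_+_ (c * f x)) (∑ᴸ-*ˡ c xs f)) (sym (ℤ.*-distribˡ-+ c (f x) _))

∑ᴸ-comm : ∀ (xs : List A) (ys : List B) (f : A → B → ℤ) →
          ∑ᴸ xs (λ x → ∑ᴸ ys (f x)) ≡ ∑ᴸ ys (λ y → ∑ᴸ xs (λ x → f x y))
∑ᴸ-comm []       ys f = sym (∑ᴸ-zero {xs = ys} (All.tabulate λ _ → refl))
∑ᴸ-comm (x ∷ xs) ys f = trans (cong (_+_ (∑ᴸ ys (f x))) (∑ᴸ-comm xs ys f))
                              (sym (∑ᴸ-+ ys (f x) λ y → ∑ᴸ xs λ x → f x y))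

sublists : List A → List (List A)
sublists []       = [] ∷ []
sublists (x ∷ xs) = sublists xs ++ map (x ∷_) (sublists xs)

∑-sublists-∏ : ∀ (xs : List A) (f : A → ℤ) →
               ∑ᴸ (sublists xs) (λ ys → ∏ᴸ ys f) ≡ ∏ᴸ xs (λ x → 1ℤ + f x)
∑-sublists-∏ []       f = refl
∑-sublists-∏ (x ∷ xs) f = begin
  ∑ᴸ (sublists (x ∷ xs)) F
    ≡⟨ ∑ᴸ-++ (sublists xs) _ F ⟩
  ∑ᴸ (sublists xs) F + ∑ᴸ (map (x ∷_) (sublists xs)) F
    ≡⟨ cong (_+_ (∑ᴸ (sublists xs) F)) (trans (∑ᴸ-map (x ∷_) (sublists xs) F) (∑ᴸ-*ˡ (f x) (sublists xs) F)) ⟩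
  ∑ᴸ (sublists xs) F + f x * ∑ᴸ (sublists xs) F
    ≡⟨ cong (λ s → s + f x * s) (∑-sublists-∏ xs f) ⟩
  ∏ᴸ xs (λ y → 1ℤ + f y) + f x * ∏ᴸ xs (λ y → 1ℤ + f y)
    ≡⟨ factor (f x) _ ⟩
  (1ℤ + f x) * ∏ᴸ xs (λ y → 1ℤ + f y) ∎
  where
  open ≡-Reasoning
  F : List _ → ℤ
  F ys = ∏ᴸ ys f
  factor : ∀ c s → s + c * s ≡ (1ℤ + c) * s
  factor = solve-∀

filter∈sublists : ∀ {P : Pred A ℓ₁} (P? : ∀ x → Dec (P x)) xs → filter P? xs ∈ sublists xs
filter∈sublists P? []       = here refl
filter∈sublists P? (x ∷ xs) with P? x
... | yes _ = Mem.∈-++⁺ʳ (sublists xs) (Mem.∈-map⁺ (x ∷_) (filter∈sublists P? xs))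
... | no  _ = Mem.∈-++⁺ˡ (filter∈sublists P? xs)

length-filter-< : ∀ {P : Pred A ℓ₁} {Q : Pred A ℓ₂} (P? : ∀ x → Dec (P x)) (Q? : ∀ x → Dec (Q x)) →
                  (∀ {x} → P x → Q x) → ∀ {x xs} → x ∈ xs → Q x → ¬ P x →
                  length (filter P? xs) ℕ.< length (filter Q? xs)
length-filter-< {P = P} {Q} P? Q? P⊆Q {xs = xs} = go xs
  where
  ≤-filter : ∀ ys → length (filter P? ys) ℕ.≤ length (filter Q? ys)
  ≤-filter []       = ℕ.z≤n
  ≤-filter (y ∷ ys) with P? y | Q? y
  ... | yes _ | yes _ = ℕ.s≤s (≤-filter ys)
  ... | yes r | no ¬s = contradiction (P⊆Q r) ¬s
  ... | no  _ | yes _ = ℕ.m≤n⇒m≤1+n (≤-filter ys)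
  ... | no  _ | no  _ = ≤-filter ys
  go : ∀ {x} ys → x ∈ ys → Q x → ¬ P x → length (filter P? ys) ℕ.< length (filter Q? ys)
  go (y ∷ ys) (here refl) Qx ¬Px with P? y | Q? y
  ... | yes r | _     = contradiction r ¬Px
  ... | no  _ | yes _ = ℕ.s≤s (≤-filter ys)
  ... | no  _ | no ¬s = contradiction Qx ¬s
  go (y ∷ ys) (there x∈) Qx ¬Px with P? y | Q? y
  ... | yes _ | yes _ = ℕ.s≤s (go ys x∈ Qx ¬Px)
  ... | yes r | no ¬s = contradiction (P⊆Q r) ¬s
  ... | no  _ | yes _ = ℕ.m≤n⇒m≤1+n (go ys x∈ Qx ¬Px)
  ... | no  _ | no  _ = go ys x∈ Qx ¬Px

-- Möbius functions of intersection lattices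

module _ {c ℓ} (S : Setoid c ℓ) where
  open Setoid S renaming (Carrier to C; _≈_ to _≋_; refl to ≋-refl; sym to ≋-sym; trans to ≋-trans)
  open SetoidMembership S using () renaming (_∈_ to _∈ˡ_)
  open SetoidUnique S using (Unique)

  ∑ᴸ-single : ∀ {g : C → ℤ} → (∀ {x y} → x ≋ y → g x ≡ g y) →
              ∀ {zs e} → Unique zs → e ∈ˡ zs → All (λ z → ¬ z ≋ e → g z ≡ 0ℤ) zs →
              ∑ᴸ zs g ≡ g e
  ∑ᴸ-single {g} g-cong {z ∷ zs} {e} (z∉ ∷ _) (here e≋z) (_ ∷ vanish) = begin
    g z + ∑ᴸ zs g ≡⟨ cong₂ _+_ (g-cong (≋-sym e≋z)) (∑ᴸ-zero rest) ⟩
    g e + 0ℤ      ≡⟨ ℤ.+-identityʳ _ ⟩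
    g e           ∎
    where
    open ≡-Reasoning
    rest : All (λ y → g y ≡ 0ℤ) zs
    rest = All.zipWith (λ (z≉y , v) → v (λ y≋e → z≉y (≋-sym (≋-trans y≋e e≋z)))) (z∉ , vanish)
  ∑ᴸ-single {g} g-cong {z ∷ zs} {e} (z∉ ∷ uniq) (there e∈) (v ∷ vanish) =
    trans (cong₂ _+_ (v z≉e) (∑ᴸ-single g-cong uniq e∈ vanish)) (ℤ.+-identityˡ _)
    where
    z≉e : ¬ z ≋ e
    z≉e z≋e = All.lookupWith (λ (z≉y) e≋y → z≉y (≋-trans z≋e e≋y)) z∉ e∈

module Möbius {V I : Set} (H : I → Pred V 0ℓ) (hs : List I) (hs-complete : ∀ h → h ∈ hs)
  (_⊢?_ : ∀ v h → Dec (∀ p → All (λ h → H h p) v → H h p)) where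

  open Intersections H
  open Poset lattice using (_≤_) renaming (Carrier to C; _≈_ to _≋_)
  module L = Poset lattice

  infix 4 _⊢_
  _⊢_ : List I → I → Set
  v ⊢ h = ∀ p → All (λ h → H h p) v → H h p

  elements : C → List I
  elements S = filter (T? ∘ S) hs

  ⟨_⟩ : List I → C
  ⟨ v ⟩ h = does (v ⊢? h)

  ⋂-elements : ∀ S → ⋂ S ≐ (λ p → All (λ h → H h p) (elements S))
  ⋂-elements S =
    (λ p∈ → All.tabulate λ {h} h∈ → p∈ h (proj₂ (Mem.∈-filter⁻ (T? ∘ S) {xs = hs} h∈))) ,
    (λ p∈ h Sh → All.lookup p∈ (Mem.∈-filter⁺ (T? ∘ S) (hs-complete h) Sh))

  ⋂-⟨⟩ : ∀ v → ⋂ ⟨ v ⟩ ≐ (λ p → All (λ h → H h p) v)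
  ⋂-⟨⟩ v =
    (λ p∈ → All.tabulate λ {h} h∈ → p∈ h (T-does (v ⊢? h) λ _ p∈v → All.lookup p∈v h∈)) ,
    (λ p∈ h Th → does-T (v ⊢? h) Th _ p∈)
    where
    T-does : ∀ {Q : Set} (d : Dec Q) → Q → T (does d)
    T-does (yes _) _ = _
    T-does (no ¬x) x = contradiction x ¬x
    does-T : ∀ {Q : Set} (d : Dec Q) → T (does d) → Q
    does-T (yes x) _ = x

  ≋-⟨elements⟩ : ∀ S → S ≋ ⟨ elements S ⟩
  ≋-⟨elements⟩ S = (λ p∈ → proj₂ (⋂-⟨⟩ (elements S)) (proj₁ (⋂-elements S) p∈)) ,
                   (λ p∈ → proj₂ (⋂-elements S) (proj₁ (⋂-⟨⟩ (elements S)) p∈))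

  ≤⇒⊢ : ∀ {S S′} → S ≤ S′ → All (elements S′ ⊢_) (elements S)
  ≤⇒⊢ {S} {S′} S≤S′ = All.tabulate λ h∈ p p∈ →
    All.lookup (proj₁ (⋂-elements S) (S≤S′ (proj₂ (⋂-elements S′) p∈))) h∈

  ⊢⇒≤ : ∀ {S S′} → All (elements S′ ⊢_) (elements S) → S ≤ S′
  ⊢⇒≤ {S} {S′} S′⊢S p∈ = proj₂ (⋂-elements S)
    (All.map (λ ⊢h → ⊢h _ (proj₁ (⋂-elements S′) p∈)) S′⊢S)

  _≤?_ : ∀ S S′ → Dec (S ≤ S′)
  S ≤? S′ = map′ (⊢⇒≤ {S} {S′}) (≤⇒⊢ {S} {S′}) (All.all? (elements S′ ⊢?_) (elements S))

  _≈?_ : ∀ S S′ → Dec (S ≋ S′)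
  S ≈? S′ = map′ swap swap ((S ≤? S′) ×-dec (S′ ≤? S))

  decSetoid : DecSetoid 0ℓ 0ℓ
  decSetoid = record { isDecEquivalence = record { isEquivalence = L.isEquivalence ; _≟_ = _≈?_ } }

  ⊢-mono : ∀ {S S′} → S ≤ S′ → ∀ {h} → elements S ⊢ h → elements S′ ⊢ h
  ⊢-mono {S} {S′} S≤S′ S⊢h p p∈ = S⊢h p (proj₁ (⋂-elements S) (S≤S′ (proj₂ (⋂-elements S′) p∈)))

  -- Hyperplanes already containing `⋂ S` are excluded: adding one to `v` flips `sign v` without
  -- changing `S ⊔ v`, so with one present the sum defining `μ S S′` would cancel to 0.
  free : C → List I
  free S = filter (λ h → ¬? (elements S ⊢? h)) hs

  infix 5 _⊔_
  _⊔_ : C → List I → C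
  S ⊔ v = ⟨ elements S ++ v ⟩

  ⋂-⊔ : ∀ S v → ⋂ (S ⊔ v) ≐ (λ p → ⋂ S p × All (λ h → H h p) v)
  ⋂-⊔ S v =
    (λ p∈ → let r = proj₁ (⋂-⟨⟩ (elements S ++ v)) p∈
            in proj₂ (⋂-elements S) (All.++⁻ˡ (elements S) r) , All.++⁻ʳ (elements S) r) ,
    (λ (p∈S , p∈v) → proj₂ (⋂-⟨⟩ (elements S ++ v)) (All.++⁺ (proj₁ (⋂-elements S) p∈S) p∈v))

  ⊔-cong : ∀ {S S′} v → S ≋ S′ → S ⊔ v ≋ S′ ⊔ v
  ⊔-cong {S} {S′} v (f , g) =
    (λ p∈ → let (s , t) = proj₁ (⋂-⊔ S v) p∈ in proj₂ (⋂-⊔ S′ v) (f s , t)) ,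
    (λ p∈ → let (s , t) = proj₁ (⋂-⊔ S′ v) p∈ in proj₂ (⋂-⊔ S v) (g s , t))

  ≤-⊔ : ∀ S v → S ≤ S ⊔ v
  ≤-⊔ S v p∈ = proj₁ (proj₁ (⋂-⊔ S v) p∈)

  sign : List I → ℤ
  sign v = ∏ᴸ v (const -1ℤ)

  μ : C → C → ℤ
  μ S S′ = ∑ᴸ (sublists (free S)) λ v → sign v * 𝟙 ((S ⊔ v) ≈? S′)

  μ-cong : ∀ {x x′ y y′} → x ≋ x′ → y ≋ y′ → μ x y ≡ μ x′ y′
  μ-cong {x} {x′} {y} {y′} x≈x′ y≈y′ = trans
    (cong (λ hs → ∑ᴸ (sublists hs) λ v → sign v * 𝟙 ((x ⊔ v) ≈? y)) free-cong)
    (∑ᴸ-cong (sublists (free x′)) λ v → cong (_*_ (sign v)) (𝟙-cong ((x ⊔ v) ≈? y) ((x′ ⊔ v) ≈? y′)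
      (λ e → L.Eq.trans (L.Eq.trans (L.Eq.sym {x ⊔ v} {x′ ⊔ v} (⊔-cong {x} {x′} v x≈x′)) e) y≈y′)
      (λ e → L.Eq.trans (L.Eq.trans (⊔-cong {x} {x′} v x≈x′) e) (L.Eq.sym {y} {y′} y≈y′))))
    where
    free-cong : free x ≡ free x′
    free-cong = List.filter-≐ _ _
      ( (λ x⊬ x′⊢ → x⊬ (⊢-mono {x′} {x} (proj₁ x≈x′) x′⊢))
      , (λ x′⊬ x⊢ → x′⊬ (⊢-mono {x} {x′} (proj₂ x≈x′) x⊢))) hs

  ∑-⊔≤ : ∀ {x y} → x ≤ y → ∑ᴸ (sublists (free x)) (λ v → sign v * 𝟙 ((x ⊔ v) ≤? y))
                         ≡ ∏ᴸ (free x) (λ h → 1ℤ + -1ℤ * 𝟙 (elements y ⊢? h))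
  ∑-⊔≤ {x} {y} x≤y = trans
    (∑ᴸ-cong (sublists (free x)) λ v → trans (cong (_*_ (sign v)) (𝟙-∏ v)) (∏ᴸ-* v _ _))
    (∑-sublists-∏ (free x) _)
    where
    ∏-𝟙 : ∀ v → 𝟙 (All.all? (elements y ⊢?_) v) ≡ ∏ᴸ v (λ h → 𝟙 (elements y ⊢? h))
    ∏-𝟙 []      = refl
    ∏-𝟙 (h ∷ v) with elements y ⊢? h
    ... | yes _ = trans (∏-𝟙 v) (sym (ℤ.*-identityˡ _))
    ... | no  _ = refl
    𝟙-∏ : ∀ v → 𝟙 ((x ⊔ v) ≤? y) ≡ ∏ᴸ v (λ h → 𝟙 (elements y ⊢? h))
    𝟙-∏ v = trans
      (𝟙-cong ((x ⊔ v) ≤? y) (All.all? (elements y ⊢?_) v)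
        (λ x⊔v≤y → All.tabulate λ h∈ p p∈ → All.lookup
          (proj₂ (proj₁ (⋂-⊔ x v) (x⊔v≤y (proj₂ (⋂-elements y) p∈)))) h∈)
        (λ y⊢v p∈ → proj₂ (⋂-⊔ x v)
          (x≤y p∈ , All.map (λ y⊢h → y⊢h _ (proj₁ (⋂-elements y) p∈)) y⊢v)))
      (∏-𝟙 v)

  μ-diagonal : ∀ x → μ x x ≡ 1ℤ
  μ-diagonal x = begin
    μ x x
      ≡⟨ ∑ᴸ-cong (sublists (free x)) (λ v → cong (_*_ (sign v))
           (𝟙-cong ((x ⊔ v) ≈? x) ((x ⊔ v) ≤? x) proj₂ (λ r → ≤-⊔ x v , r))) ⟩
    ∑ᴸ (sublists (free x)) (λ v → sign v * 𝟙 ((x ⊔ v) ≤? x))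
      ≡⟨ ∑-⊔≤ {x} {x} id ⟩
    ∏ᴸ (free x) (λ h → 1ℤ + -1ℤ * 𝟙 (elements x ⊢? h))
      ≡⟨ ∏ᴸ-one (All.tabulate λ {h} h∈ → cong (λ s → 1ℤ + -1ℤ * s)
           (𝟙-no (elements x ⊢? h) (proj₂ (Mem.∈-filter⁻ _ {xs = hs} h∈)))) ⟩
    1ℤ ∎
    where open ≡-Reasoning

  infix 4 _<_
  _<_ : C → C → Set
  x < y = x ≤ y × ¬ x ≋ y

  <-witness : ∀ {x y} → x < y → ∃[ h ] elements y ⊢ h × ¬ elements x ⊢ h
  <-witness {x} {y} (x≤y , x≉y) =
    let h , h∈ , x⊬h = find (All.¬All⇒Any¬ (elements x ⊢?_) (elements y)
                         λ x⊢y → x≉y (⊢⇒≤ {y} {x} x⊢y , x≤y))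
    in h , (λ p p∈ → All.lookup p∈ h∈) , x⊬h

  μ-∑ : ∀ {x y zs} → x < y → Enumerates lattice ([_,_] lattice x y) zs → ∑ᴸ zs (μ x) ≡ 0ℤ
  μ-∑ {x} {y} {zs} x<y@(x≤y , _) enum = begin
    ∑ᴸ zs (μ x)
      ≡⟨ ∑ᴸ-comm zs (sublists (free x)) (λ z v → sign v * 𝟙 ((x ⊔ v) ≈? z)) ⟩
    ∑ᴸ (sublists (free x)) (λ v → ∑ᴸ zs λ z → sign v * 𝟙 ((x ⊔ v) ≈? z))
      ≡⟨ ∑ᴸ-cong (sublists (free x)) (λ v →
           trans (∑ᴸ-*ˡ (sign v) zs _) (cong (_*_ (sign v)) (count v))) ⟩
    ∑ᴸ (sublists (free x)) (λ v → sign v * 𝟙 ((x ⊔ v) ≤? y))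
      ≡⟨ ∑-⊔≤ {x} {y} x≤y ⟩
    ∏ᴸ (free x) (λ h → 1ℤ + -1ℤ * 𝟙 (elements y ⊢? h))
      ≡⟨ (let h , y⊢h , x⊬h = <-witness x<y in
          ∏ᴸ-zero (Mem.∈-filter⁺ (λ h → ¬? (elements x ⊢? h)) (hs-complete h) x⊬h)
            (cong (λ s → 1ℤ + -1ℤ * s) (𝟙-yes (elements y ⊢? h) y⊢h))) ⟩
    0ℤ ∎
    where
    open ≡-Reasoning
    open Enumerates enum
    count : ∀ v → ∑ᴸ zs (λ z → 𝟙 ((x ⊔ v) ≈? z)) ≡ 𝟙 ((x ⊔ v) ≤? y)
    count v = count-dec ((x ⊔ v) ≤? y)
      where
      count-dec : (d : Dec (x ⊔ v ≤ y)) → ∑ᴸ zs (λ z → 𝟙 ((x ⊔ v) ≈? z)) ≡ 𝟙 d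
      count-dec (yes x⊔v≤y) = trans
        (∑ᴸ-single L.Eq.setoid
          (λ {z} {z′} z≈z′ → 𝟙-cong ((x ⊔ v) ≈? z) ((x ⊔ v) ≈? z′)
            (λ e → L.Eq.trans e z≈z′) (λ e → L.Eq.trans e (L.Eq.sym {z} {z′} z≈z′)))
          unique (complete (≤-⊔ x v , x⊔v≤y))
          (All.tabulate λ {z} _ z≉ → 𝟙-no ((x ⊔ v) ≈? z) (z≉ ∘ L.Eq.sym {x ⊔ v} {z})))
        (𝟙-yes ((x ⊔ v) ≈? (x ⊔ v)) (L.Eq.refl {x ⊔ v}))
      count-dec (no x⊔v≰y) = ∑ᴸ-zero
        (All.map (λ {z} (_ , z≤y) → 𝟙-no ((x ⊔ v) ≈? z) λ e → x⊔v≰y λ p∈ → proj₂ e (z≤y p∈)) sound)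

  -- Representatives up to `_≋_` suffice: each `S` is `≋` to the closure of `elements S`, which is a
  -- sublist of `hs`.
  interval : C → C → List C
  interval x y = deduplicate _≈?_
    (filter (λ z → (x ≤? z) ×-dec (z ≤? y)) (map ⟨_⟩ (sublists hs)))

  interval-enumerates : ∀ x y → Enumerates lattice ([_,_] lattice x y) (interval x y)
  interval-enumerates x y = record
    { sound    = All.deduplicate⁺ _≈?_ (All.all-filter _ (map ⟨_⟩ (sublists hs)))
    ; complete = λ {z} (x≤z , z≤y) →
        SMem.∈-deduplicate⁺ L.Eq.setoid _≈?_
          (λ {u} {v} {w} w≋v u≋v → L.Eq.trans {u} {v} {w} u≋v (L.Eq.sym {w} {v} w≋v))
          (SMem.∈-filter⁺ L.Eq.setoid _
            (λ {z} {z′} → interval-resp z z′)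
            (every z) (x≤z , z≤y))
    ; unique   = Unique.deduplicate-! decSetoid _
    }
    where
    interval-resp : ∀ z z′ → z ≋ z′ → [_,_] lattice x y z → [_,_] lattice x y z′
    interval-resp z z′ (f , g) (x≤z , z≤y) = (λ p∈ → x≤z (g p∈)) , (λ p∈ → f (z≤y p∈))
    every : ∀ z → SetoidMembership._∈_ L.Eq.setoid z (map ⟨_⟩ (sublists hs))
    every z = Any.map⁺ (Any.map (λ { refl → ≋-⟨elements⟩ z }) (filter∈sublists (T? ∘ z) hs))

  μ-isMöbius : IsMöbius lattice μ
  μ-isMöbius = record
    { μ-cong     = λ {x} {x′} {y} {y′} → μ-cong {x} {x′} {y} {y′}
    ; μ-diagonal = μ-diagonal
    ; μ-interval = λ {x} {y} x<y →
        interval x y , interval-enumerates x y , μ-∑ x<y (interval-enumerates x y)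
    }

  -- Counts the hyperplanes containing `⋂ x`; this is not the rank in the lattice, only a strictly
  -- increasing measure for induction.
  rank : C → ℕ
  rank x = length (filter (elements x ⊢?_) hs)

  rank-mono-< : ∀ {x y} → x < y → rank x ℕ.< rank y
  rank-mono-< {x} {y} x<y = let h , y⊢h , x⊬h = <-witness x<y in
    length-filter-< (elements x ⊢?_) (elements y ⊢?_) (⊢-mono {x} {y} (proj₁ x<y))
      (hs-complete h) y⊢h x⊬h

  -- Induction on `rank y`. On the list that `ν` supplies for the interval, the difference `Δ`
  -- vanishes away from `y` by induction, and its sum is 0 because `μ-∑` holds for every
  -- enumeration; so it vanishes at `y`.
  μ-unique : ∀ {ν} → IsMöbius lattice ν → ∀ {x y} → x ≤ y → ν x y ≡ μ x y
  μ-unique {ν} isMöbius {x} {y} = go (suc (rank y)) y ℕ.≤-refl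
    where
    open ≡-Reasoning
    open IsMöbius isMöbius using ()
      renaming (μ-cong to ν-cong; μ-diagonal to ν-diagonal; μ-interval to ν-interval)
    Δ : C → ℤ
    Δ z = ν x z + -1ℤ * μ x z
    Δ≡0⇒≡ : ∀ a b → a + -1ℤ * b ≡ 0ℤ → a ≡ b
    Δ≡0⇒≡ a b eq = trans (lem a b) (trans (cong (_+ b) eq) (ℤ.+-identityˡ b))
      where
      lem : ∀ a b → a ≡ (a + -1ℤ * b) + b
      lem = solve-∀
    cancel : ∀ a → a + -1ℤ * a ≡ 0ℤ
    cancel = solve-∀
    go : ∀ r y → rank y ℕ.< r → x ≤ y → ν x y ≡ μ x y
    go (suc r) y rank≤r x≤y with x ≈? y
    ... | yes x≈y = begin
      ν x y ≡⟨ ν-cong (L.Eq.refl {x}) (L.Eq.sym {x} {y} x≈y) ⟩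
      ν x x ≡⟨ trans (ν-diagonal x) (sym (μ-diagonal x)) ⟩
      μ x x ≡⟨ μ-cong {x} {x} {x} {y} (L.Eq.refl {x}) x≈y ⟩
      μ x y ∎
    ... | no x≉y with ν-interval (x≤y , x≉y)
    ...   | zs , enum , ∑ν≡0 = Δ≡0⇒≡ _ _ (begin
      Δ y                                  ≡⟨ ∑ᴸ-single L.Eq.setoid {Δ}
                                                (λ {z} {z′} z≈z′ → cong₂ (λ s t → s + -1ℤ * t)
                                                  (ν-cong (L.Eq.refl {x}) z≈z′)
                                                  (μ-cong {x} {x} {z} {z′} (L.Eq.refl {x}) z≈z′))
                                                unique (complete (x≤y , id))
                                                (All.map (λ {z} → vanish {z}) sound) ⟨
      ∑ᴸ zs Δ                              ≡⟨ ∑ᴸ-+ zs (ν x) (λ z → -1ℤ * μ x z) ⟩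
      ∑ᴸ zs (ν x) + ∑ᴸ zs (λ z → -1ℤ * μ x z)
        ≡⟨ cong₂ _+_ ∑ν≡0 (trans (∑ᴸ-*ˡ -1ℤ zs (μ x)) (cong (_*_ -1ℤ) (μ-∑ (x≤y , x≉y) enum))) ⟩
      0ℤ ∎)
      where
      open Enumerates enum
      vanish : ∀ {z} → [_,_] lattice x y z → ¬ z ≋ y → Δ z ≡ 0ℤ
      vanish {z} (x≤z , z≤y) z≉y = trans
        (cong (λ s → s + -1ℤ * μ x z)
          (go r z (ℕ.≤-trans (rank-mono-< {z} {y} (z≤y , z≉y)) (ℕ.s≤s⁻¹ rank≤r)) x≤z))
        (cancel (μ x z))

  -- Whitney's sum over the spanning subsets. The hypothesis says that no hyperplane is the whole
  -- space, which makes all of them free at `0̂`.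
  μ-0̂-1̂ : (∀ h → ∃[ p ] ¬ H h p) →
          μ 0̂ 1̂ ≡ ∑ᴸ (sublists hs) (λ v → sign v * 𝟙 (All.all? (v ⊢?_) hs))
  μ-0̂-1̂ nontrivial = trans
    (cong (λ hs → ∑ᴸ (sublists hs) λ v → sign v * 𝟙 ((0̂ ⊔ v) ≈? 1̂)) free-0̂)
    (∑ᴸ-cong (sublists hs) λ v → cong (_*_ (sign v)) (𝟙-cong ((0̂ ⊔ v) ≈? 1̂) (All.all? (v ⊢?_) hs)
      (λ (⊆1̂ , _) → All.tabulate λ {h} _ p p∈ → ⊆1̂ (proj₂ (⋂-⊔ 0̂ v) ((λ _ ()) , p∈)) h _)
      (λ v⊢ → (λ p∈ h _ → All.lookup v⊢ (hs-complete h) _ (proj₂ (proj₁ (⋂-⊔ 0̂ v) p∈))) ,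
              1̂-maximum (0̂ ⊔ v))))
    where
    free-0̂ : free 0̂ ≡ hs
    free-0̂ = List.filter-all _ (All.tabulate λ {h} _ 0̂⊢h → let p , p∉ = nontrivial h in
      p∉ (0̂⊢h p (All.tabulate λ h∈ → ⊥-elim (proj₂ (Mem.∈-filter⁻ (T? ∘ 0̂) {xs = hs} h∈)))))

-- Connectedness and the linear coefficient of the chromatic polynomial

∑-const : ∀ k x → sum {k} (const x) ≡ + k * x
∑-const zero    x = refl
∑-const (suc k) x = trans (cong (_+_ x) (∑-const k x)) (step x (+ k))
  where
  step : ∀ x m → x + m * x ≡ (1ℤ + m) * x
  step = solve-∀

∑-zero : ∀ {k} (t : Fin k → ℤ) → (∀ c → t c ≡ 0ℤ) → sum t ≡ 0ℤ
∑-zero {k} t t≡0 = trans (sum-cong-≗ t≡0) (trans (∑-const k 0ℤ) (ℤ.*-zeroʳ (+ k)))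

∑-𝟙 : ∀ {k} (d : Fin k) (t : Fin k → ℤ) → sum (λ c → 𝟙 (c Fin.≟ d) * t c) ≡ t d
∑-𝟙 zero    t = trans (cong₂ _+_ (ℤ.*-identityˡ (t zero)) (∑-zero (λ c → 0ℤ * t (suc c)) λ _ → refl))
                      (ℤ.+-identityʳ (t zero))
∑-𝟙 (suc d) t = trans (ℤ.+-identityˡ _) (∑-𝟙 d (t ∘ suc))

infixr 5 _◂_
_◂_ : A → (Fin N → A) → Fin (suc N) → A
(x ◂ f) zero    = x
(x ◂ f) (suc i) = f i

Weight : ℕ → Set
Weight N = ∀ k → (Fin N → Fin k) → ℤ

-- A new vertex takes one of the k colours in use or one of t - k others; only
-- the part linear in t is kept, so that the last factor t - k becomes - k.
extend : Weight (suc N) → Weight N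
extend F k f = sum (λ c → F k (c ◂ f)) + - (+ k * F (suc k) (zero ◂ suc ∘ f))

-- Vertices are coloured from the last index down to `zero`. The first one has `t` colours; this is
-- the factor `t` whose coefficient is taken, so it counts as 1 and all later factors are evaluated
-- at `t = 0`.
𝔼 : ∀ N → Weight (suc N) → ℤ
𝔼 zero    F = F 1 (const zero)
𝔼 (suc N) F = 𝔼 N (extend F)

extend-cong : {F G : Weight (suc N)} → (∀ k f → F k f ≡ G k f) → ∀ k f → extend F k f ≡ extend G k f
extend-cong F≗G k f = cong₂ (λ s t → s + - (+ k * t)) (sum-cong-≗ λ c → F≗G k (c ◂ f)) (F≗G _ _)

𝔼-cong : ∀ N {F G : Weight (suc N)} → (∀ k f → F k f ≡ G k f) → 𝔼 N F ≡ 𝔼 N G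
𝔼-cong zero    F≗G = F≗G _ _
𝔼-cong (suc N) F≗G = 𝔼-cong N (extend-cong F≗G)

𝔼-zero : ∀ N → 𝔼 N (λ k f → 0ℤ) ≡ 0ℤ
𝔼-zero zero    = refl
𝔼-zero (suc N) = trans
  (𝔼-cong N λ k f → cong₂ (λ s t → s + - t) (∑-zero {k} (const 0ℤ) λ _ → refl) (ℤ.*-zeroʳ (+ k)))
  (𝔼-zero N)

𝔼-+* : ∀ N (F : Weight (suc N)) a (G : Weight (suc N)) →
       𝔼 N (λ k f → a * F k f + G k f) ≡ a * 𝔼 N F + 𝔼 N G
𝔼-+* zero    F a G = refl
𝔼-+* (suc N) F a G = trans (𝔼-cong N extend-+*) (𝔼-+* N (extend F) a (extend G))
  where
  regroup : ∀ a k s t u v → (a * s + t) + - (k * (a * u + v)) ≡ a * (s + - (k * u)) + (t + - (k * v))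
  regroup = solve-∀
  extend-+* : ∀ k f → extend (λ k f → a * F k f + G k f) k f ≡ a * extend F k f + extend G k f
  extend-+* k f = trans
    (cong (_+ - (+ k * (a * F (suc k) f₀ + G (suc k) f₀)))
      (trans (∑-distrib-+ (λ c → a * F k (c ◂ f)) (λ c → G k (c ◂ f)))
             (cong (_+ sum λ c → G k (c ◂ f)) (sym (*-distribˡ-sum a λ c → F k (c ◂ f))))))
    (regroup a (+ k) (sum λ c → F k (c ◂ f)) (sum λ c → G k (c ◂ f)) (F (suc k) f₀) (G (suc k) f₀))
    where
    f₀ = zero ◂ suc ∘ f

𝔼-∑ᴸ : ∀ N (xs : List A) (a : A → ℤ) (F : A → Weight (suc N)) →
       𝔼 N (λ k f → ∑ᴸ xs λ x → a x * F x k f) ≡ ∑ᴸ xs λ x → a x * 𝔼 N (F x)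
𝔼-∑ᴸ N []       a F = 𝔼-zero N
𝔼-∑ᴸ N (x ∷ xs) a F = trans (𝔼-+* N (F x) (a x) _) (cong (_+_ (a x * 𝔼 N (F x))) (𝔼-∑ᴸ N xs a F))

-- Edge sets: connected or cut

Edge : ℕ → Set
Edge N = Fin N × Fin N

agree : (Fin N → Fin k) → Edge N → ℤ
agree f (u , v) = 𝟙 (f u Fin.≟ f v)

Respects : (S : Setoid 0ℓ 0ℓ) → (Fin N → Setoid.Carrier S) → List (Edge N) → Set
Respects S f = All λ (u , v) → Setoid._≈_ S (f u) (f v)

-- Labels range over arbitrary setoids because the instance needed is ℝ with `_≈_`. `Cut` is the
-- positive refutation, with decidable labels.
Connects : List (Edge N) → Set₁
Connects es = ∀ S f → Respects S f es → ∀ u v → Setoid._≈_ S (f u) (f v)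

Cut : List (Edge N) → Set
Cut es = ∃[ f ] Respects (setoid Bool) f es × ∃₂ λ u v → f u ≢ f v

collapse : Fin N → Fin (suc N) → Fin N
collapse u = u ◂ id

collapseᴱ : Fin N → Edge (suc N) → Edge N
collapseᴱ u (a , b) = collapse u a , collapse u b

Joined : List (Edge (suc N)) → Fin N → Set
Joined es u = (zero , suc u) ∈ es ⊎ (suc u , zero) ∈ es

module _ (u : Fin N) {es : List (Edge (suc N))} where
  ∏-agree-collapse : ∀ (f : Fin N → Fin k) → ∏ᴸ es (agree (f u ◂ f)) ≡ ∏ᴸ (map (collapseᴱ u) es) (agree f)
  ∏-agree-collapse f = sym (trans (∏ᴸ-map (collapseᴱ u) es (agree f))
    (∏ᴸ-cong es λ (a , b) → cong₂ (λ x y → 𝟙 (x Fin.≟ y)) (lift a) (lift b)))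
    where
    lift : ∀ a → f (collapse u a) ≡ (f u ◂ f) a
    lift zero    = refl
    lift (suc _) = refl

  ∏-agree-joined : Joined es u → ∀ c (f : Fin N → Fin k) →
    ∏ᴸ es (agree (c ◂ f)) ≡ 𝟙 (c Fin.≟ f u) * ∏ᴸ (map (collapseᴱ u) es) (agree f)
  ∏-agree-joined joined c f with c Fin.≟ f u
  ... | yes refl = trans (∏-agree-collapse f) (sym (ℤ.*-identityˡ _))
  ... | no  c≢fu = vanish joined
    where
    vanish : Joined es u → ∏ᴸ es (agree (c ◂ f)) ≡ 0ℤ
    vanish (inj₁ e∈) = ∏ᴸ-zero e∈ (𝟙-no (c Fin.≟ f u) c≢fu)
    vanish (inj₂ e∈) = ∏ᴸ-zero e∈ (𝟙-no (f u Fin.≟ c) (c≢fu ∘ sym))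

  joined-Connects : Joined es u → Connects (map (collapseᴱ u) es) → Connects es
  joined-Connects joined conn S f resp a b = S.trans (near a) (S.trans
      (conn S (f ∘ suc) (All.map⁺ (All.map (λ {e} → step e) resp)) (collapse u a) (collapse u b))
      (S.sym (near b)))
    where
    module S = Setoid S
    base : Joined es u → f zero S.≈ f (suc u)
    base (inj₁ e∈) = All.lookup resp e∈
    base (inj₂ e∈) = S.sym (All.lookup resp e∈)
    near : ∀ a → f a S.≈ f (suc (collapse u a))
    near zero    = base joined
    near (suc _) = S.refl
    step : ∀ ((a , b) : Edge _) → f a S.≈ f b → f (suc (collapse u a)) S.≈ f (suc (collapse u b))
    step (a , b) fa≈fb = S.trans (S.sym (near a)) (S.trans fa≈fb (near b))

  collapse-Cut : Cut (map (collapseᴱ u) es) → Cut es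
  collapse-Cut (f , resp , a , b , fa≢fb) =
    f u ◂ f , All.map (λ {e} → step e) (All.map⁻ resp) , suc a , suc b , fa≢fb
    where
    lift : ∀ a → (f u ◂ f) a ≡ f (collapse u a)
    lift zero    = refl
    lift (suc _) = refl
    step : ∀ ((a , b) : Edge _) → f (collapse u a) ≡ f (collapse u b) → (f u ◂ f) a ≡ (f u ◂ f) b
    step (a , b) eq = trans (lift a) (trans eq (sym (lift b)))

joins? : ∀ (es : List (Edge (suc N))) → Dec (∃ (Joined es))
joins? es = Fin.any? λ u → ((zero , suc u) ∈? es) ⊎-dec ((suc u , zero) ∈? es)
  where open DecMembership (Product.≡-dec Fin._≟_ Fin._≟_) using (_∈?_)

module _ {es : List (Edge (suc N))} (isolated : ¬ ∃ (Joined es)) where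
  ∏-agree-isolated : ∀ u c (f : Fin N → Fin k) → ∏ᴸ es (agree (c ◂ f)) ≡ ∏ᴸ (map (collapseᴱ u) es) (agree f)
  ∏-agree-isolated u c f = trans
    (∏ᴸ-cong-All (All.tabulate λ {e} → step e)) (sym (∏ᴸ-map (collapseᴱ u) es (agree f)))
    where
    step : ∀ e → e ∈ es → agree (c ◂ f) e ≡ agree f (collapseᴱ u e)
    step (zero  , zero)  _  = trans (𝟙-yes (c Fin.≟ c) refl) (sym (𝟙-yes (f u Fin.≟ f u) refl))
    step (zero  , suc b) e∈ = contradiction (b , inj₁ e∈) isolated
    step (suc a , zero)  e∈ = contradiction (a , inj₂ e∈) isolated
    step (suc a , suc b) _  = refl

  isolated-Cut : Fin N → Cut es
  isolated-Cut u = (true ◂ const false) , All.tabulate (λ {e} → step e) , zero , suc u , λ ()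
    where
    step : ∀ ((a , b) : Edge _) → (a , b) ∈ es → (true ◂ const false) a ≡ (true ◂ const false) b
    step (zero  , zero)  _  = refl
    step (zero  , suc b) e∈ = contradiction (b , inj₁ e∈) isolated
    step (suc a , zero)  e∈ = contradiction (a , inj₂ e∈) isolated
    step (suc a , suc b) _  = refl

-- With `t` colours, the colourings constant along the edges number `t` to the power of the number
-- of components, so the coefficient of `t` is 1 for connected edge sets and 0 otherwise. If vertex
-- `zero` is joined to `suc u`, it must repeat that colour and the two are contracted; if not, its
-- `k` old and `- k` new colours cancel.
𝔼-agree : ∀ N (es : List (Edge (suc N))) →
          (Connects es × 𝔼 N (λ k f → ∏ᴸ es (agree f)) ≡ 1ℤ) ⊎
          (Cut es × 𝔼 N (λ k f → ∏ᴸ es (agree f)) ≡ 0ℤ)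
𝔼-agree zero    es = inj₁ ((λ { S f _ zero zero → Setoid.refl S }) , ∏ᴸ-one {xs = es} (All.tabulate λ _ → refl))
𝔼-agree (suc N) es with joins? es
... | yes (u , joined) = lift (𝔼-agree N (map (collapseᴱ u) es))
  where
  open ≡-Reasoning
  es′ = map (collapseᴱ u) es
  drop-zero : ∀ s k t → s + - (k * (0ℤ * t)) ≡ s
  drop-zero = solve-∀
  reduce : ∀ k f → extend (λ k f → ∏ᴸ es (agree f)) k f ≡ ∏ᴸ es′ (agree f)
  reduce k f = begin
    extend (λ k f → ∏ᴸ es (agree f)) k f
      ≡⟨ cong₂ (λ s t → s + - (+ k * t))
           (trans (sum-cong-≗ λ c → ∏-agree-joined u joined c f) (∑-𝟙 (f u) _))
           (∏-agree-joined u joined zero λ x → Fin.suc (f x)) ⟩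
    ∏ᴸ es′ (agree f) + - (+ k * (0ℤ * ∏ᴸ es′ (agree λ x → Fin.suc (f x))))
      ≡⟨ drop-zero _ (+ k) (∏ᴸ es′ (agree λ x → Fin.suc (f x))) ⟩
    ∏ᴸ es′ (agree f) ∎
  lift : (Connects es′ × _ ≡ 1ℤ) ⊎ (Cut es′ × _ ≡ 0ℤ) → _
  lift (inj₁ (conn , eq)) = inj₁ (joined-Connects u joined conn , trans (𝔼-cong N reduce) eq)
  lift (inj₂ (cut  , eq)) = inj₂ (collapse-Cut u cut , trans (𝔼-cong N reduce) eq)
... | no isolated = inj₂ (isolated-Cut isolated zero , trans (𝔼-cong N vanish) (𝔼-zero N))
  where
  -- Only loops meet the isolated vertex, so the vertex it is collapsed onto is arbitrary.
  es′ = map (collapseᴱ zero) es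
  vanish : ∀ k f → extend (λ k f → ∏ᴸ es (agree f)) k f ≡ 0ℤ
  vanish k f = trans
    (cong₂ (λ s t → s + - (+ k * t))
      (trans (sum-cong-≗ λ c → ∏-agree-isolated isolated zero c f) (∑-const k _))
      (∏-agree-isolated isolated zero zero λ x → Fin.suc (f x)))
    (ℤ.+-inverseʳ (+ k * ∏ᴸ es′ (agree f)))

-- The graph of the homogenized Linial arrangement

gandhi : ℕ → ℤ → ℤ
gandhi zero    x = x
gandhi (suc j) x = x * x * (gandhi j (1ℤ + x) + - gandhi j x)

-- With z i = x i - y i and w j = x (j + 1), indexed from 0, the hyperplanes are
-- z i = w j for i ≤ j. The vertices are ordered z 0, w 0, z 1, w 1, ….
zpos wpos : Fin n → Fin (n ℕ.* 2)
zpos zero    = zero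
zpos (suc i) = suc (suc (zpos i))
wpos zero    = suc zero
wpos (suc j) = suc (suc (wpos j))

¬𝟙 : Fin k → Fin k → ℤ
¬𝟙 c d = 1ℤ + -1ℤ * 𝟙 (c Fin.≟ d)

fresh : ∀ n → (Fin (n ℕ.* 2) → Fin k) → Fin k → ℤ
fresh zero    f c = 1ℤ
fresh (suc n) f c = ¬𝟙 c (f (suc zero)) * fresh n (λ v → f (suc (suc v))) c

-- fresh (suc n) f does not depend on the colour of the vertex z 0, which is
-- absent here.
fresh⁺ : ∀ n → (Fin (suc (n ℕ.* 2)) → Fin k) → Fin k → ℤ
fresh⁺ n f c = ¬𝟙 c (f zero) * fresh n (λ v → f (suc v)) c

proper : ∀ n → (Fin (n ℕ.* 2) → Fin k) → ℤ
proper zero    f = 1ℤ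
proper (suc n) f = fresh (suc n) f (f zero) * proper n (λ v → f (suc (suc v)))

used : (Fin k → ℤ) → ℤ
used φ = sum λ c → 1ℤ + -1ℤ * φ c

fresh-zero : ∀ n (f : Fin (n ℕ.* 2) → Fin k) → fresh n (λ v → suc (f v)) zero ≡ 1ℤ
fresh-zero zero    f = refl
fresh-zero (suc n) f = trans (ℤ.*-identityˡ _) (fresh-zero n λ v → f (suc (suc v)))

fresh-suc : ∀ n (f : Fin (n ℕ.* 2) → Fin k) c → fresh n (λ v → Fin.suc (f v)) (suc c) ≡ fresh n f c
fresh-suc zero    f c = refl
fresh-suc (suc n) f c = cong (¬𝟙 c (f (suc zero)) *_) (fresh-suc n (λ v → f (suc (suc v))) c)

proper-suc : ∀ n (f : Fin (n ℕ.* 2) → Fin k) → proper n (λ v → Fin.suc (f v)) ≡ proper n f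
proper-suc zero    f = refl
proper-suc (suc n) f = cong₂ _*_ (fresh-suc (suc n) f (f zero)) (proper-suc n λ v → f (suc (suc v)))

fresh-01 : ∀ n (f : Fin (n ℕ.* 2) → Fin k) c → fresh n f c ≡ 0ℤ ⊎ fresh n f c ≡ 1ℤ
fresh-01 zero    f c = inj₂ refl
fresh-01 (suc n) f c with c Fin.≟ f (suc zero) | fresh-01 n (λ v → f (suc (suc v))) c
... | yes _ | _       = inj₁ refl
... | no  _ | inj₁ eq = inj₁ (trans (ℤ.*-identityˡ _) eq)
... | no  _ | inj₂ eq = inj₂ (trans (ℤ.*-identityˡ _) eq)

used-fresh⁺-suc : ∀ n (f : Fin (suc (n ℕ.* 2)) → Fin k) →
                  used (fresh⁺ n λ v → Fin.suc (f v)) ≡ used (fresh⁺ n f)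
used-fresh⁺-suc n f = trans
  (cong₂ _+_ (cong (λ s → 1ℤ + -1ℤ * (1ℤ * s)) (fresh-zero n λ v → f (suc v)))
    (sum-cong-≗ λ c → cong (λ s → 1ℤ + -1ℤ * (¬𝟙 c (f zero) * s)) (fresh-suc n (λ v → f (suc v)) c)))
  (ℤ.+-identityˡ _)

used-complement : ∀ (φ : Fin k → ℤ) → sum φ ≡ + k + - used φ
used-complement {k} φ = begin
  sum φ
    ≡⟨ rearrange (+ k) (sum φ) ⟩
  + k + - (+ k * 1ℤ + -1ℤ * sum φ)
    ≡⟨ cong (λ s → + k + - s) (cong₂ _+_ (sym (∑-const k 1ℤ)) (*-distribˡ-sum -1ℤ φ)) ⟩
  + k + - (sum {k} (λ _ → 1ℤ) + sum (λ c → -1ℤ * φ c))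
    ≡⟨ cong (λ s → + k + - s) (∑-distrib-+ {k} (λ _ → 1ℤ) (λ c → -1ℤ * φ c)) ⟨
  + k + - used φ ∎
  where
  open ≡-Reasoning
  rearrange : ∀ k s → s ≡ k + - (k * 1ℤ + -1ℤ * s)
  rearrange = solve-∀

-- The vertex `z 0` must avoid the `u` colours on the `w` side: `k - u` old choices and `- k` formal
-- new ones add up to `- u`, and `k` drops out. The argument of `g` is unaffected, since no `w` is
-- coloured.
extend-z : ∀ n (g : ℤ → ℤ) k (f : Fin (suc (n ℕ.* 2)) → Fin k) →
  extend (λ k f → proper (suc n) f * g (used (fresh (suc n) f))) k f ≡
  proper n (λ v → f (suc v)) * - (used (fresh⁺ n f) * g (used (fresh⁺ n f)))
extend-z n g k f = begin
  sum (λ c → (fresh⁺ n f c * p) * g u) + - (+ k * ((fresh⁺ n (λ v → suc (f v)) zero * p′) * g u′))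
    ≡⟨ cong₂ (λ s t → s + - (+ k * t))
         (trans (sym (*-distribʳ-sum (g u) λ c → fresh⁺ n f c * p))
                (cong (_* g u) (sym (*-distribʳ-sum p (fresh⁺ n f)))))
         (cong₂ (λ s t → s * g t)
           (cong₂ _*_ (trans (ℤ.*-identityˡ _) (fresh-zero n λ v → f (suc v))) (proper-suc n λ v → f (suc v)))
           (used-fresh⁺-suc n f)) ⟩
  (sum (fresh⁺ n f) * p) * g u + - (+ k * ((1ℤ * p) * g u))
    ≡⟨ cong (λ s → (s * p) * g u + - (+ k * ((1ℤ * p) * g u))) (used-complement (fresh⁺ n f)) ⟩
  ((+ k + - u) * p) * g u + - (+ k * ((1ℤ * p) * g u))
    ≡⟨ simplify (+ k) u p (g u) ⟩
  p * - (u * g u) ∎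
  where
  open ≡-Reasoning
  p = proper n (λ v → f (suc v))
  p′ = proper n (λ v → suc (f (suc v)))
  u = used (fresh⁺ n f)
  u′ = used (fresh⁺ n λ v → suc (f v))
  simplify : ∀ k u p g → ((k + - u) * p) * g + - (k * ((1ℤ * p) * g)) ≡ p * - (u * g)
  simplify = solve-∀

used-fresh⁺-◂ : ∀ n (f : Fin (n ℕ.* 2) → Fin k) c →
                used (fresh⁺ n (c ◂ f)) ≡ used (fresh n f) + fresh n f c
used-fresh⁺-◂ n f c = begin
  used (fresh⁺ n (c ◂ f))
    ≡⟨ sum-cong-≗ (λ d → expand (𝟙 (d Fin.≟ c)) (fresh n f d)) ⟩
  sum (λ d → (1ℤ + -1ℤ * fresh n f d) + 𝟙 (d Fin.≟ c) * fresh n f d)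
    ≡⟨ ∑-distrib-+ (λ d → 1ℤ + -1ℤ * fresh n f d) (λ d → 𝟙 (d Fin.≟ c) * fresh n f d) ⟩
  used (fresh n f) + sum (λ d → 𝟙 (d Fin.≟ c) * fresh n f d)
    ≡⟨ cong (_+_ (used (fresh n f))) (∑-𝟙 c (fresh n f)) ⟩
  used (fresh n f) + fresh n f c ∎
  where
  open ≡-Reasoning
  expand : ∀ i x → 1ℤ + -1ℤ * ((1ℤ + -1ℤ * i) * x) ≡ (1ℤ + -1ℤ * x) + i * x
  expand = solve-∀

used-fresh⁺-new : ∀ n (f : Fin (n ℕ.* 2) → Fin k) →
                  used (fresh⁺ n (zero ◂ λ v → suc (f v))) ≡ 1ℤ + used (fresh n f)
used-fresh⁺-new n f = cong (_+_ 1ℤ) (sum-cong-≗ λ c →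
  cong (λ s → 1ℤ + -1ℤ * s) (trans (ℤ.*-identityˡ _) (fresh-suc n f c)))

-- The neighbours of this `w` are all coloured later, so it is unconstrained. Repeating one of the
-- `u` colours of the `w` side leaves `u` unchanged; the `k - u` other old colours and the `- k` new
-- ones, together `- u`, raise it by one.
extend-w : ∀ n (h : ℤ → ℤ) k (f : Fin (n ℕ.* 2) → Fin k) →
  extend (λ k f → proper n (λ v → f (suc v)) * h (used (fresh⁺ n f))) k f ≡
  proper n f * (used (fresh n f) * (h (used (fresh n f)) + - h (1ℤ + used (fresh n f))))
extend-w n h k f = begin
  sum (λ c → p * h (used (fresh⁺ n (c ◂ f)))) +
    - (+ k * (proper n (λ v → suc (f v)) * h (used (fresh⁺ n (zero ◂ λ v → suc (f v))))))
    ≡⟨ cong₂ (λ s t → s + - (+ k * t))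
         (trans (sum-cong-≗ λ c → cong (p *_) (interpolate c))
         (trans (sum-cong-≗ λ c → factor p (h u) Δ (fresh n f c))
         (trans (∑-distrib-+ (λ _ → p * h u) (λ c → (p * Δ) * fresh n f c))
                (cong₂ _+_ (∑-const k (p * h u)) (sym (*-distribˡ-sum (p * Δ) (fresh n f)))))))
         (cong₂ (λ s t → s * h t) (proper-suc n f) (used-fresh⁺-new n f)) ⟩
  (+ k * (p * h u) + (p * Δ) * sum (fresh n f)) + - (+ k * (p * h (1ℤ + u)))
    ≡⟨ cong (λ s → (+ k * (p * h u) + (p * Δ) * s) + - (+ k * (p * h (1ℤ + u)))) (used-complement (fresh n f)) ⟩
  (+ k * (p * h u) + (p * Δ) * (+ k + - u)) + - (+ k * (p * h (1ℤ + u)))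
    ≡⟨ simplify (+ k) p (h u) (h (1ℤ + u)) u ⟩
  p * (u * (h u + - h (1ℤ + u))) ∎
  where
  open ≡-Reasoning
  p = proper n f
  u = used (fresh n f)
  Δ = h (1ℤ + u) + - h u
  factor : ∀ p a d x → p * (a + x * d) ≡ p * a + (p * d) * x
  factor = solve-∀
  simplify : ∀ k p a b u → (k * (p * a) + (p * (b + - a)) * (k + - u)) + - (k * (p * b)) ≡ p * (u * (a + - b))
  simplify = solve-∀
  at-one : ∀ a b → b ≡ a + 1ℤ * (b + - a)
  at-one = solve-∀
  -- fresh is 0 or 1, so h may be replaced by its chord between u and 1 + u.
  interpolate : ∀ c → h (used (fresh⁺ n (c ◂ f))) ≡ h u + fresh n f c * Δ
  interpolate c = trans (cong h (used-fresh⁺-◂ n f c)) (chord (fresh-01 n f c))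
    where
    chord : fresh n f c ≡ 0ℤ ⊎ fresh n f c ≡ 1ℤ → h (u + fresh n f c) ≡ h u + fresh n f c * Δ
    chord (inj₁ eq) rewrite eq = trans (cong h (ℤ.+-identityʳ u)) (sym (ℤ.+-identityʳ (h u)))
    chord (inj₂ eq) rewrite eq = trans (cong h (ℤ.+-comm u 1ℤ)) (at-one (h u) (h (1ℤ + u)))

-- `g` collects the contribution of the `j` pairs of vertices already summed out. The hypothesis is
-- on `x * g x` because summing out the next `z` supplies the factor `x`, up to sign. That sign
-- reverses the difference produced by the following `w`; the final `z` has no such `w`, whence the
-- sign of the result.
𝔼-staircase : ∀ m j (g : ℤ → ℤ) → (∀ x → x * g x ≡ gandhi j x) →
  𝔼 (suc (m ℕ.* 2)) (λ k f → proper (suc m) f * g (used (fresh (suc m) f))) ≡ - gandhi (j ℕ.+ m) 1ℤ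
𝔼-staircase zero j g x*g = begin
  𝔼 1 (λ k f → proper 1 f * g (used (fresh 1 f))) ≡⟨ extend-z 0 g 1 (const zero) ⟩
  1ℤ * - (1ℤ * g 1ℤ)                              ≡⟨ ℤ.*-identityˡ _ ⟩
  - (1ℤ * g 1ℤ)                                   ≡⟨ cong -_ (x*g 1ℤ) ⟩
  - gandhi j 1ℤ                                   ≡⟨ cong (λ i → - gandhi i 1ℤ) (ℕ.+-identityʳ j) ⟨
  - gandhi (j ℕ.+ zero) 1ℤ                        ∎
  where open ≡-Reasoning
𝔼-staircase (suc m) j g x*g = begin
  𝔼 (suc (m ℕ.* 2)) (extend (extend F))
    ≡⟨ 𝔼-cong (suc (m ℕ.* 2)) (λ k f →
         trans (extend-cong (extend-z (suc m) g) k f) (extend-w (suc m) (λ x → - (x * g x)) k f)) ⟩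
  𝔼 (suc (m ℕ.* 2)) (λ k f → proper (suc m) f * g′ (used (fresh (suc m) f)))
    ≡⟨ 𝔼-staircase m (suc j) g′ x*g′ ⟩
  - gandhi (suc j ℕ.+ m) 1ℤ
    ≡⟨ cong (λ i → - gandhi i 1ℤ) (ℕ.+-suc j m) ⟨
  - gandhi (j ℕ.+ suc m) 1ℤ ∎
  where
  open ≡-Reasoning
  F : Weight (suc (suc m) ℕ.* 2)
  F k f = proper (suc (suc m)) f * g (used (fresh (suc (suc m)) f))
  g′ : ℤ → ℤ
  g′ x = x * (- (x * g x) + - - ((1ℤ + x) * g (1ℤ + x)))
  regroup : ∀ x a b → x * (x * (- a + - - b)) ≡ x * x * (b + - a)
  regroup = solve-∀
  x*g′ : ∀ x → x * g′ x ≡ gandhi (suc j) x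
  x*g′ x = trans (cong₂ (λ a b → x * (x * (- a + - - b))) (x*g x) (x*g (1ℤ + x)))
                 (regroup x (gandhi j x) (gandhi j (1ℤ + x)))

shift : Pair n → Pair (suc n)
shift (i , j , i<j) = suc i , suc j , s≤s i<j

pairs : ∀ n → List (Pair n)
pairs zero    = []
pairs (suc n) = map (λ j → zero , suc j , z<s) (allFin (suc n)) ++ map shift (pairs n)

pairs-complete : ∀ (h : Pair n) → h ∈ pairs n
pairs-complete {suc n} (zero  , suc j , s≤s z≤n) = Mem.∈-++⁺ˡ (Mem.∈-map⁺ _ (Mem.∈-allFin j))
pairs-complete {suc n} (suc i , suc j , s≤s i<j) =
  Mem.∈-++⁺ʳ (map _ (allFin (suc n))) (Mem.∈-map⁺ shift (pairs-complete (i , j , i<j)))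

edge : Pair n → Edge (n ℕ.* 2)
edge (i , suc j , _) = zpos i , wpos j

∏-fresh : ∀ n (f : Fin (n ℕ.* 2) → Fin k) c → ∏ᴸ (allFin n) (λ j → ¬𝟙 c (f (wpos j))) ≡ fresh n f c
∏-fresh zero    f c = refl
∏-fresh (suc n) f c = cong (¬𝟙 c (f (suc zero)) *_) (begin
  ∏ᴸ (tabulate {n = n} Fin.suc) (λ (j : Fin (suc n)) → ¬𝟙 c (f (wpos j)))
    ≡⟨ cong (λ js → ∏ᴸ js (λ (j : Fin (suc n)) → ¬𝟙 c (f (wpos j)))) (List.map-tabulate id Fin.suc) ⟨
  ∏ᴸ (map suc (allFin n)) (λ (j : Fin (suc n)) → ¬𝟙 c (f (wpos j)))
    ≡⟨ ∏ᴸ-map suc (allFin n) _ ⟩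
  ∏ᴸ (allFin n) (λ j → ¬𝟙 c (f (suc (suc (wpos j)))))
    ≡⟨ ∏-fresh n (λ v → f (suc (suc v))) c ⟩
  fresh n (λ v → f (suc (suc v))) c ∎)
  where open ≡-Reasoning

∏-proper : ∀ n (f : Fin (n ℕ.* 2) → Fin k) →
           ∏ᴸ (pairs n) (λ h → 1ℤ + -1ℤ * agree f (edge h)) ≡ proper n f
∏-proper zero    f = refl
∏-proper (suc n) f = trans (∏ᴸ-++ (map _ (allFin (suc n))) (map shift (pairs n)) F) (cong₂ _*_
  (trans (∏ᴸ-map _ (allFin (suc n)) F) (∏-fresh (suc n) f (f zero)))
  (trans (∏ᴸ-map shift (pairs n) F) (trans (∏ᴸ-cong (pairs n) shifted) (∏-proper n λ v → f (suc (suc v))))))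
  where
  F : Pair (suc n) → ℤ
  F h = 1ℤ + -1ℤ * agree f (edge h)
  shifted : ∀ h → F (shift h) ≡ 1ℤ + -1ℤ * agree (λ v → f (suc (suc v))) (edge h)
  shifted (i , suc j , _) = refl

-- From hyperplanes to edges

Implies : List (Edge N) → Edge N → Set₁
Implies es (u , v) = ∀ S f → Respects S f es → Setoid._≈_ S (f u) (f v)

Separates : List (Edge N) → Edge N → Set
Separates es (u , v) = ∃[ f ] Respects (setoid Bool) f es × f u ≢ f v

module _ {N : ℕ} where
  relabel : Fin N → Fin N → Fin N → Fin N
  relabel x y w with w Fin.≟ y
  ... | yes _ = x
  ... | no  _ = w

  relabel-target : ∀ x y → relabel x y y ≡ x
  relabel-target x y with y Fin.≟ y
  ... | yes _  = refl
  ... | no y≢y = contradiction refl y≢y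

  relabel-fixed : ∀ x y → relabel x y x ≡ x
  relabel-fixed x y with x Fin.≟ y
  ... | yes _ = refl
  ... | no  _ = refl

  -- Union by relabelling: a new edge `(a , b)` sends the label of `b` to that of `a`. Labels are
  -- themselves vertices, so the last component says that a respecting labelling is determined by
  -- its values at the labels.
  componentLabel : ∀ (es : List (Edge N)) → ∃[ ℓ ] Respects (setoid (Fin N)) ℓ es ×
                   (∀ S f → Respects S f es → ∀ u → Setoid._≈_ S (f u) (f (ℓ u)))
  componentLabel []             = id , [] , λ S f _ u → Setoid.refl S
  componentLabel ((a , b) ∷ es) with componentLabel es
  ... | ℓ , ℓ-resp , factor =
    relabel (ℓ a) (ℓ b) ∘ ℓ ,
    trans (relabel-fixed (ℓ a) (ℓ b)) (sym (relabel-target (ℓ a) (ℓ b))) ∷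
      All.map (cong (relabel (ℓ a) (ℓ b))) ℓ-resp ,
    factor′
    where
    factor′ : ∀ S f → Respects S f ((a , b) ∷ es) →
              ∀ u → Setoid._≈_ S (f u) (f (relabel (ℓ a) (ℓ b) (ℓ u)))
    factor′ S f (fa≈fb ∷ resp) u with ℓ u Fin.≟ ℓ b | factor S f resp u
    ... | no  _  | fu≈ = fu≈
    ... | yes eq | fu≈ rewrite eq =
      S.trans fu≈ (S.trans (S.sym (factor S f resp b)) (S.trans (S.sym fa≈fb) (factor S f resp a)))
      where module S = Setoid S

  -- If the component labels differ, the indicator of the component of `u` separates.
  implies-or-separates : ∀ (es : List (Edge N)) e → Implies es e ⊎ Separates es e
  implies-or-separates es (u , v) with componentLabel es
  ... | ℓ , ℓ-resp , factor with ℓ u Fin.≟ ℓ v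
  ...   | yes ℓu≡ℓv = inj₁ λ S f resp → let module S = Setoid S in
            S.trans (factor S f resp u)
              (S.trans (S.reflexive (cong f ℓu≡ℓv)) (S.sym (factor S f resp v)))
  ...   | no  ℓu≢ℓv = inj₂ (isℓu ∘ ℓ , All.map (cong isℓu) ℓ-resp , differ)
    where
    isℓu : Fin N → Bool
    isℓu w = does (ℓ u Fin.≟ w)
    differ : isℓu (ℓ u) ≢ isℓu (ℓ v)
    differ eq with ℓ u Fin.≟ ℓ u | ℓ u Fin.≟ ℓ v
    differ eq | yes _    | yes r = ℓu≢ℓv r
    differ () | yes _    | no  _
    differ eq | no ℓu≢ℓu | _     = ℓu≢ℓu refl

-- Edge equations at real points

ℚ-norm-swap : ∀ p q → ℚ.∣ p ℚ.- q ∣ ≡ ℚ.∣ q ℚ.- p ∣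
ℚ-norm-swap p q = trans (cong ℚ.∣_∣ (negated p q)) (ℚ.∣-p∣≡∣p∣ (q ℚ.- p))
  where
  open +-*-Solver
  negated : ∀ p q → p ℚ.- q ≡ ℚ.- (q ℚ.- p)
  negated = solve 2 (λ p q → p :- q := :- (q :- p)) refl

ℝ-setoid : Setoid 0ℓ 0ℓ
ℝ-setoid = record
  { Carrier = ℝ
  ; _≈_     = _≈_
  ; isEquivalence = record
    { refl  = λ {x} ε 0<ε → 0 , λ n _ → subst (ℚ._< ε) (sym (cong ℚ.∣_∣ (ℚ.+-inverseʳ (seq x n)))) 0<ε
    ; sym   = λ {x} {y} x≈y ε 0<ε → let M , hx = x≈y ε 0<ε in
                M , λ n n≥ → subst (ℚ._< ε) (ℚ-norm-swap (seq x n) (seq y n)) (hx n n≥)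
    ; trans = λ {x} {y} {z} x≈y y≈z ε 0<ε →
        let 0<½ε   = ℚ.*-monoʳ-<-pos ½ 0<ε
            M , hx = x≈y (½ ℚ.* ε) 0<½ε
            K , hz = y≈z (½ ℚ.* ε) 0<½ε
        in M ℕ.⊔ K , λ n n≥ → triangle ε (seq x n) (seq y n) (seq z n)
             (hx n (ℕ.≤-trans (ℕ.m≤m⊔n M K) n≥)) (hz n (ℕ.≤-trans (ℕ.m≤n⊔m M K) n≥))
    }
  }
  where
  open +-*-Solver
  telescope : ∀ a b c → a ℚ.- c ≡ (a ℚ.- b) ℚ.+ (b ℚ.- c)
  telescope = solve 3 (λ a b c → a :- c := (a :- b) :+ (b :- c)) refl
  halves : ∀ ε → ½ ℚ.* ε ℚ.+ ½ ℚ.* ε ≡ ε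
  halves = solve 1 (λ e → con ½ :* e :+ con ½ :* e := e) refl
  triangle : ∀ ε a b c → ℚ.∣ a ℚ.- b ∣ ℚ.< ½ ℚ.* ε → ℚ.∣ b ℚ.- c ∣ ℚ.< ½ ℚ.* ε → ℚ.∣ a ℚ.- c ∣ ℚ.< ε
  triangle ε a b c p q = begin-strict
    ℚ.∣ a ℚ.- c ∣                     ≡⟨ cong ℚ.∣_∣ (telescope a b c) ⟩
    ℚ.∣ (a ℚ.- b) ℚ.+ (b ℚ.- c) ∣     ≤⟨ ℚ.∣p+q∣≤∣p∣+∣q∣ (a ℚ.- b) (b ℚ.- c) ⟩
    ℚ.∣ a ℚ.- b ∣ ℚ.+ ℚ.∣ b ℚ.- c ∣   <⟨ ℚ.+-mono-< p q ⟩
    ½ ℚ.* ε ℚ.+ ½ ℚ.* ε               ≡⟨ halves ε ⟩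
    ε                                 ∎
    where open ℚ.≤-Reasoning

module ≈ = Setoid ℝ-setoid

-- The change of coordinates: it turns `x i - x j ≈ y i` into `x i - y i ≈ x j`, and, being its own
-- inverse, back again.
-‿exchange : ∀ a b c → a - b ≈ c → a - c ≈ b
-‿exchange a b c a-b≈c ε 0<ε = let M , h = a-b≈c ε 0<ε in
  M , λ n n≥ → subst (ℚ._< ε) (cong ℚ.∣_∣ (exchange (seq a n) (seq b n) (seq c n))) (h n n≥)
  where
  open +-*-Solver
  exchange : ∀ a b c → (a ℚ.- b) ℚ.- c ≡ (a ℚ.- c) ℚ.- b
  exchange = solve 3 (λ a b c → (a :- b) :- c := (a :- c) :- b) refl

bitℚ : Bool → ℚ
bitℚ b = if b then 1ℚ else 0ℚ

bit : Bool → ℝ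
bit b = mkℝ (const (bitℚ b)) λ ε 0<ε → 0 , λ _ _ _ _ →
  subst (ℚ._< ε) (sym (cong ℚ.∣_∣ (ℚ.+-inverseʳ (bitℚ b)))) 0<ε

bit-injective : ∀ b c → bit b ≈ bit c → b ≡ c
bit-injective b c eq = let M , h = eq ½ (ℚ.positive⁻¹ ½) in near b c (h M ℕ.≤-refl)
  where
  near : ∀ b c → ℚ.∣ bitℚ b ℚ.- bitℚ c ∣ ℚ.< ½ → b ≡ c
  near false false _ = refl
  near false true  p = contradiction p (from-no (1ℚ ℚ.<? ½))
  near true  false p = contradiction p (from-no (1ℚ ℚ.<? ½))
  near true  true  _ = refl

a-[a-b]≈b : ∀ a b → a - (a - b) ≈ b
a-[a-b]≈b a b = -‿exchange a b (a - b) (≈.refl {a - b})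

interleave : {A : Set} → (Fin n → A) → (Fin n → A) → Fin (n ℕ.* 2) → A
interleave {suc n} f g zero          = f zero
interleave {suc n} f g (suc zero)    = g zero
interleave {suc n} f g (suc (suc v)) = interleave (f ∘ suc) (g ∘ suc) v

interleave-zpos : ∀ {A : Set} (f g : Fin n → A) i → interleave f g (zpos i) ≡ f i
interleave-zpos f g zero    = refl
interleave-zpos f g (suc i) = interleave-zpos (f ∘ suc) (g ∘ suc) i

interleave-wpos : ∀ {A : Set} (f g : Fin n → A) j → interleave f g (wpos j) ≡ g j
interleave-wpos f g zero    = refl
interleave-wpos f g (suc j) = interleave-wpos (f ∘ suc) (g ∘ suc) j

zpos-or-wpos : ∀ (v : Fin (n ℕ.* 2)) → (∃ λ (i : Fin n) → v ≡ zpos i) ⊎ (∃ λ (j : Fin n) → v ≡ wpos j)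
zpos-or-wpos {suc n} zero          = inj₁ (zero , refl)
zpos-or-wpos {suc n} (suc zero)    = inj₂ (zero , refl)
zpos-or-wpos {suc n} (suc (suc v)) with zpos-or-wpos {n} v
... | inj₁ (i , refl) = inj₁ (suc i , refl)
... | inj₂ (j , refl) = inj₂ (suc j , refl)

potential : Point n → Fin (n ℕ.* 2) → ℝ
potential (x , y) = interleave (λ i → x (inject₁ i) - y i) (x ∘ suc)

potential-zpos : ∀ (x : Fin (suc n) → ℝ) (y : Fin n → ℝ) i →
                 potential (x , y) (zpos i) ≡ x (inject₁ i) - y i
potential-zpos x y = interleave-zpos (λ i → x (inject₁ i) - y i) (x ∘ suc)

potential-wpos : ∀ (x : Fin (suc n) → ℝ) (y : Fin n → ℝ) j → potential (x , y) (wpos j) ≡ x (suc j)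
potential-wpos x y = interleave-wpos (λ i → x (inject₁ i) - y i) (x ∘ suc)

potential-zpos-≈ : ∀ (x : Fin (suc n) → ℝ) (z : Fin n → ℝ) i →
                   potential (x , λ i → x (inject₁ i) - z i) (zpos i) ≈ z i
potential-zpos-≈ x z i = subst (_≈ z i) (sym (potential-zpos x (λ i → x (inject₁ i) - z i) i))
                               (a-[a-b]≈b (x (inject₁ i)) (z i))

AgreesOn : (p : Point n) → Edge (n ℕ.* 2) → Set
AgreesOn p (u , v) = potential p u ≈ potential p v

hyperplane⇒agrees : ∀ (p : Point n) h → hyperplane h p → AgreesOn p (edge h)
hyperplane⇒agrees (x , y) (i , suc j , _) p∈ =
  subst₂ _≈_ (sym (potential-zpos x y i)) (sym (potential-wpos x y j))
    (-‿exchange (x (inject₁ i)) (x (suc j)) (y i) p∈)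

agrees⇒hyperplane : ∀ (p : Point n) h → AgreesOn p (edge h) → hyperplane h p
agrees⇒hyperplane (x , y) (i , suc j , _) u≈v =
  -‿exchange (x (inject₁ i)) (y i) (x (suc j))
    (subst₂ _≈_ (potential-zpos x y i) (potential-wpos x y j) u≈v)

RealisedAt : (Fin (n ℕ.* 2) → ℝ) → Point n → Set
RealisedAt g p = ∀ v → potential p v ≈ g v

Cuts : (Fin (n ℕ.* 2) → Bool) → Point n → Set
Cuts {n} f p = ∀ (h : Pair n) → (hyperplane h p → f (proj₁ (edge h)) ≡ f (proj₂ (edge h))) ×
                 (f (proj₁ (edge h)) ≡ f (proj₂ (edge h)) → hyperplane h p)

realised⇒cuts : ∀ (f : Fin (n ℕ.* 2) → Bool) (p : Point n) →
                RealisedAt {n} (λ v → bit (f v)) p → Cuts {n} f p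
realised⇒cuts {n} f p p≈f h =
  (λ p∈ → bit-injective (f u) (f v)
    (≈.trans {bit (f u)} {potential p u} {bit (f v)} (≈.sym {potential p u} {bit (f u)} (p≈f u))
      (≈.trans {potential p u} {potential p v} {bit (f v)} (hyperplane⇒agrees p h p∈) (p≈f v)))) ,
  (λ fu≡fv → agrees⇒hyperplane p h
    (≈.trans {potential p u} {bit (f u)} {potential p v} (p≈f u)
      (subst (λ b → bit b ≈ potential p v) (sym fu≡fv) (≈.sym {potential p v} {bit (f v)} (p≈f v)))))
  where
  u = proj₁ (edge h)
  v = proj₂ (edge h)

realise : ∀ (g : Fin (n ℕ.* 2) → ℝ) → ∃ (RealisedAt {n} g)
realise {n} g = (x , λ i → x (inject₁ i) - g (zpos i)) , λ v → at (zpos-or-wpos {n} v)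
  where
  -- `x zero` belongs to no vertex, and the value prescribed at `z 0` is met through `y 0`; so 0 is
  -- an arbitrary choice.
  x : Fin (suc n) → ℝ
  x = bit false ◂ λ j → g (wpos j)
  at : ∀ {v} → (∃ λ (i : Fin n) → v ≡ zpos i) ⊎ (∃ λ (j : Fin n) → v ≡ wpos j) →
       potential (x , λ i → x (inject₁ i) - g (zpos i)) v ≈ g v
  at (inj₁ (i , refl)) = potential-zpos-≈ x (λ i → g (zpos i)) i
  at (inj₂ (j , refl)) = ≈.reflexive (potential-wpos x (λ i → x (inject₁ i) - g (zpos i)) j)

cutPoint : ∀ (f : Fin (n ℕ.* 2) → Bool) → ∃ (Cuts {n} f)
cutPoint {n} f = let p , p≈f = realise {n} (λ v → bit (f v)) in p , realised⇒cuts {n} f p p≈f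

Implies⇒⊢ : ∀ (hs : List (Pair n)) h → Implies (map edge hs) (edge h) →
            ∀ p → All (λ h → hyperplane h p) hs → hyperplane h p
Implies⇒⊢ hs h implies p p∈ =
  agrees⇒hyperplane p h (implies ℝ-setoid (potential p)
    (All.map⁺ (All.map (λ {h} → hyperplane⇒agrees p h) p∈)))

cut-∈ : ∀ (hs : List (Pair n)) f → Respects (setoid Bool) f (map edge hs) →
        ∀ (p : Point n) → Cuts {n} f p → All (λ h → hyperplane h p) hs
cut-∈ hs f resp p cuts = All.map (λ {h} → proj₂ (cuts h)) (All.map⁻ resp)

separates⇒⊬ : ∀ (hs : List (Pair n)) h → Separates (map edge hs) (edge h) →
              ¬ (∀ p → All (λ h → hyperplane h p) hs → hyperplane h p)
separates⇒⊬ {n} hs h (f , resp , fu≢fv) ⊢h = refute (cutPoint {n} f)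
  where
  refute : ¬ ∃ (Cuts {n} f)
  refute (p , cuts) = fu≢fv (proj₁ (cuts h) (⊢h p (cut-∈ {n} hs f resp p cuts)))

linial-⊢? : ∀ (hs : List (Pair n)) h → Dec (∀ p → All (λ h → hyperplane h p) hs → hyperplane h p)
linial-⊢? hs h with implies-or-separates (map edge hs) (edge h)
... | inj₁ implies   = yes (Implies⇒⊢ hs h implies)
... | inj₂ separates = no (separates⇒⊬ hs h separates)

-- Every `z i` is joined to the last `w`, and every `w j` to `z 0`, so the whole graph is connected.
-- Hence the hyperplanes of an edge set with a cut cannot force all the others.
constant : ∀ m (f : Fin (suc m ℕ.* 2) → Bool) →
           (∀ (h : Pair (suc m)) → f (proj₁ (edge h)) ≡ f (proj₂ (edge h))) → ∀ v → f v ≡ f zero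
constant m f agrees v with zpos-or-wpos {suc m} v
... | inj₁ (i , refl) = trans (agrees (i , suc (fromℕ m) , i<last)) (sym (agrees (zero , suc (fromℕ m) , z<s)))
  where
  i<last : inject₁ i Fin.< suc (fromℕ m)
  i<last rewrite Fin.toℕ-inject₁ i | Fin.toℕ-fromℕ m = Fin.toℕ<n i
... | inj₂ (j , refl) = sym (agrees (zero , suc j , z<s))

module LinialMöbius (n : ℕ) = Möbius (hyperplane {n}) (pairs n) pairs-complete linial-⊢?

-- The indicator of a spanning `v` in Whitney's sum is `𝔼` of a product of agreements. By linearity
-- the signed sum over `v` moves inside `𝔼`, where for each colouring it factors into `1 - agree`
-- over all edges, the indicator of a proper colouring.
linial-μ : ∀ m → let open LinialMöbius (suc m); open Linial (suc m) in μ 0̂ 1̂ ≡ - gandhi m 1ℤ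
linial-μ m = begin
  μ 0̂ 1̂
    ≡⟨ μ-0̂-1̂ nontrivial ⟩
  ∑ᴸ (sublists hs) (λ v → sign v * 𝟙 (All.all? (linial-⊢? v) hs))
    ≡⟨ ∑ᴸ-cong (sublists hs) (λ v → cong (sign v *_) (spanning v)) ⟩
  ∑ᴸ (sublists hs) (λ v → sign v * 𝔼 M (λ k f → ∏ᴸ (map edge v) (agree f)))
    ≡⟨ 𝔼-∑ᴸ M (sublists hs) sign (λ v k f → ∏ᴸ (map edge v) (agree f)) ⟨
  𝔼 M (λ k f → ∑ᴸ (sublists hs) λ v → sign v * ∏ᴸ (map edge v) (agree f))
    ≡⟨ 𝔼-cong M (λ k f → trans
         (∑ᴸ-cong (sublists hs) λ v → trans (cong (sign v *_) (∏ᴸ-map edge v (agree f))) (∏ᴸ-* v _ _))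
         (trans (∑-sublists-∏ hs _) (trans (∏-proper (suc m) f) (sym (ℤ.*-identityʳ _))))) ⟩
  𝔼 M (λ k f → proper (suc m) f * 1ℤ)
    -- No pair is summed out yet: `g = 1` fits `gandhi 0 x = x`.
    ≡⟨ 𝔼-staircase m 0 (const 1ℤ) ℤ.*-identityʳ ⟩
  - gandhi m 1ℤ ∎
  where
  open ≡-Reasoning
  open LinialMöbius (suc m)
  open Linial (suc m)
  M = suc (m ℕ.* 2)
  hs = pairs (suc m)
  nontrivial : ∀ h → ∃[ p ] ¬ hyperplane h p
  nontrivial h@(i , suc j , _) = avoid (cutPoint {suc m} f)
    where
    f : Fin (suc m ℕ.* 2) → Bool
    -- The bipartition cuts every edge, so its point avoids every hyperplane.
    f = interleave {suc m} (const true) (const false)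
    differ : f (zpos i) ≢ f (wpos j)
    differ eq with trans (sym (interleave-zpos {suc m} (const true) (const false) i))
                         (trans eq (interleave-wpos {suc m} (const true) (const false) j))
    ... | ()
    avoid : ∃ (Cuts {suc m} f) → ∃[ p ] ¬ hyperplane h p
    avoid (p , cuts) = p , λ p∈ → differ (proj₁ (cuts h) p∈)
  spanning : ∀ v → 𝟙 (All.all? (linial-⊢? v) hs) ≡ 𝔼 M (λ k f → ∏ᴸ (map edge v) (agree f))
  spanning v = case (𝔼-agree M (map edge v))
    where
    case : (Connects (map edge v) × _ ≡ 1ℤ) ⊎ (Cut (map edge v) × _ ≡ 0ℤ) → _
    case (inj₁ (connects , eq)) = trans
      (𝟙-yes (All.all? (linial-⊢? v) hs) (All.tabulate λ {h} _ →
        Implies⇒⊢ v h λ S f resp → connects S f resp _ _))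
      (sym eq)
    case (inj₂ ((f , resp , a , b , fa≢fb) , eq)) = trans
      (𝟙-no (All.all? (linial-⊢? v) hs) λ v⊢ →
        fa≢fb (trans (const-f v⊢ (cutPoint {suc m} f) a) (sym (const-f v⊢ (cutPoint {suc m} f) b))))
      (sym eq)
      where
      const-f : All (λ h → ∀ p → All (λ h → hyperplane h p) v → hyperplane h p) hs →
                ∃ (Cuts {suc m} f) → ∀ u → f u ≡ f zero
      const-f v⊢ (p , cuts) = constant m f λ h → proj₁ (cuts h)
        (All.lookup v⊢ (pairs-complete h) p (cut-∈ {suc m} v f resp p cuts))

-- Counting Dumont permutations

Row : ℕ → Set
Row K = Fin K → ℤ

infixl 6 _∖_
_∖_ : Row K → Fin K → Row K
(V ∖ c) d = V d * ¬𝟙 d c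

-- Expansion along the rows. A used column gets weight 0 in `V` instead of being removed, so that
-- the remaining rows keep their indexing by `Fin K`.
permanent : List (Row K) → Row K → ℤ
permanent []       V = 1ℤ
permanent (A ∷ As) V = sum λ c → (A c * V c) * permanent As (V ∖ c)

¬𝟙-sym : ∀ (c d : Fin K) → ¬𝟙 c d ≡ ¬𝟙 d c
¬𝟙-sym c d = cong (λ s → 1ℤ + -1ℤ * s) (𝟙-cong (c Fin.≟ d) (d Fin.≟ c) sym sym)

permanent-cong : ∀ (As : List (Row K)) {V V′} → V ≗ V′ → permanent As V ≡ permanent As V′
permanent-cong []       V≗V′ = refl
permanent-cong (A ∷ As) V≗V′ = sum-cong-≗ λ c →
  cong₂ (λ v p → (A c * v) * p) (V≗V′ c) (permanent-cong As λ d → cong (_* ¬𝟙 d c) (V≗V′ d))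

permanent-head-cong : ∀ {A B : Row K} As V → A ≗ B → permanent (A ∷ As) V ≡ permanent (B ∷ As) V
permanent-head-cong As V A≗B = sum-cong-≗ λ c → cong (λ a → (a * V c) * permanent As (V ∖ c)) (A≗B c)

permanent-tail-cong : ∀ (A : Row K) As Bs V → (∀ V → permanent As V ≡ permanent Bs V) →
                      permanent (A ∷ As) V ≡ permanent (A ∷ Bs) V
permanent-tail-cong A As Bs V As≡Bs = sum-cong-≗ λ c → cong ((A c * V c) *_) (As≡Bs (V ∖ c))

permanent-swap : ∀ (A B : Row K) As V → permanent (A ∷ B ∷ As) V ≡ permanent (B ∷ A ∷ As) V
permanent-swap A B As V = begin
  sum (λ c → (A c * V c) * sum λ d → (B d * (V ∖ c) d) * permanent As (V ∖ c ∖ d))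
    ≡⟨ sum-cong-≗ (λ c → *-distribˡ-sum (A c * V c) (λ d → (B d * (V ∖ c) d) * permanent As (V ∖ c ∖ d))) ⟩
  sum (λ c → sum λ d → (A c * V c) * ((B d * (V ∖ c) d) * permanent As (V ∖ c ∖ d)))
    ≡⟨ ∑-comm (λ c d → (A c * V c) * ((B d * (V ∖ c) d) * permanent As (V ∖ c ∖ d))) ⟩
  sum (λ d → sum λ c → (A c * V c) * ((B d * (V ∖ c) d) * permanent As (V ∖ c ∖ d)))
    ≡⟨ sum-cong-≗ (λ d → sum-cong-≗ (exchange d)) ⟩
  sum (λ d → sum λ c → (B d * V d) * ((A c * (V ∖ d) c) * permanent As (V ∖ d ∖ c)))
    ≡⟨ sum-cong-≗ (λ d → *-distribˡ-sum (B d * V d) (λ c → (A c * (V ∖ d) c) * permanent As (V ∖ d ∖ c))) ⟨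
  sum (λ d → (B d * V d) * sum λ c → (A c * (V ∖ d) c) * permanent As (V ∖ d ∖ c)) ∎
  where
  open ≡-Reasoning
  rearrange : ∀ a v b w i p → (a * v) * ((b * (w * i)) * p) ≡ (b * w) * ((a * (v * i)) * p)
  rearrange = solve-∀
  rotate : ∀ v i j → (v * i) * j ≡ (v * j) * i
  rotate = solve-∀
  exchange : ∀ d c → (A c * V c) * ((B d * (V ∖ c) d) * permanent As (V ∖ c ∖ d)) ≡
                     (B d * V d) * ((A c * (V ∖ d) c) * permanent As (V ∖ d ∖ c))
  exchange d c = trans (rearrange (A c) (V c) (B d) (V d) (¬𝟙 d c) _)
    (cong₂ (λ i p → (B d * V d) * ((A c * (V c * i)) * p)) (¬𝟙-sym d c)
      (permanent-cong As λ e → rotate (V e) (¬𝟙 e c) (¬𝟙 e d)))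

-- Serves to postpone an unrestricted row: once the restricted rows are filled, its number of
-- choices is just the number of columns left.
permanent-move : ∀ (A : Row K) As Bs V → permanent (A ∷ As ++ Bs) V ≡ permanent (As ++ A ∷ Bs) V
permanent-move A []       Bs V = refl
permanent-move A (C ∷ As) Bs V =
  trans (permanent-swap A C (As ++ Bs) V) (permanent-tail-cong C (A ∷ As ++ Bs) (As ++ A ∷ Bs) V (permanent-move A As Bs))

full : Row K
full _ = 1ℤ

permanent-complement : ∀ (B : Row K) As V → permanent ((λ c → 1ℤ + -1ℤ * B c) ∷ As) V ≡
                                            permanent (full ∷ As) V + -1ℤ * permanent (B ∷ As) V
permanent-complement B As V = begin
  sum (λ c → ((1ℤ + -1ℤ * B c) * V c) * permanent As (V ∖ c))
    ≡⟨ sum-cong-≗ (λ c → expand (B c) (V c) (permanent As (V ∖ c))) ⟩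
  sum (λ c → (1ℤ * V c) * permanent As (V ∖ c) + -1ℤ * ((B c * V c) * permanent As (V ∖ c)))
    ≡⟨ ∑-distrib-+ (λ c → (1ℤ * V c) * permanent As (V ∖ c)) _ ⟩
  permanent (full ∷ As) V + sum (λ c → -1ℤ * ((B c * V c) * permanent As (V ∖ c)))
    ≡⟨ cong (_+_ (permanent (full ∷ As) V))
         (*-distribˡ-sum -1ℤ (λ c → (B c * V c) * permanent As (V ∖ c))) ⟨
  permanent (full ∷ As) V + -1ℤ * permanent (B ∷ As) V ∎
  where
  open ≡-Reasoning
  expand : ∀ b v p → ((1ℤ + -1ℤ * b) * v) * p ≡ (1ℤ * v) * p + -1ℤ * ((b * v) * p)
  expand = solve-∀

-- Nested rows and the signed walk

below : ℕ → Row K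
below a c = 𝟙 (toℕ c ℕ.<? a)

-- All that the later rows can see of `V`: each is built from `full` and some `below b` with
-- `b ≥ a`, so their permanent depends on `V` only through `κ`.
record Available (V : Row K) (a : ℕ) (κ : ℤ) : Set where
  field
    binary : ∀ c → V c ≡ 0ℤ ⊎ V c ≡ 1ℤ
    above  : ∀ c → a ℕ.≤ toℕ c → V c ≡ 1ℤ
    count  : sum (λ c → below a c * V c) ≡ κ

open Available

available-suc : ∀ {V : Row K} {a κ} → a ℕ.< K → Available V a κ → Available V (suc a) (1ℤ + κ)
available-suc {K} {V} {a} {κ} a<K av = record
  { binary = binary av
  ; above  = λ c a<c → above av c (ℕ.<⇒≤ a<c)
  ; count  = begin
      sum (λ c → below (suc a) c * V c)
        ≡⟨ sum-cong-≗ (λ c → trans (cong (_* V c) (split c)) (ℤ.*-distribʳ-+ (V c) (𝟙 (c Fin.≟ a′)) (below a c))) ⟩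
      sum (λ c → 𝟙 (c Fin.≟ a′) * V c + below a c * V c)
        ≡⟨ ∑-distrib-+ (λ c → 𝟙 (c Fin.≟ a′) * V c) (λ c → below a c * V c) ⟩
      sum (λ c → 𝟙 (c Fin.≟ a′) * V c) + sum (λ c → below a c * V c)
        ≡⟨ cong₂ _+_ (trans (∑-𝟙 a′ V) (above av a′ (ℕ.≤-reflexive (sym (Fin.toℕ-fromℕ< a<K))))) (count av) ⟩
      1ℤ + κ ∎
  }
  where
  open ≡-Reasoning
  a′ : Fin K
  a′ = fromℕ< a<K
  split : ∀ c → below (suc a) c ≡ 𝟙 (c Fin.≟ a′) + below a c
  split c with c Fin.≟ a′
  ... | yes refl rewrite Fin.toℕ-fromℕ< a<K =
    trans (𝟙-yes (a ℕ.<? suc a) ℕ.≤-refl) (sym (cong (_+_ 1ℤ) (𝟙-no (a ℕ.<? a) (ℕ.<-irrefl refl))))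
  ... | no c≢a′ = trans
    (𝟙-cong (toℕ c ℕ.<? suc a) (toℕ c ℕ.<? a)
      (λ c≤a → ℕ.≤∧≢⇒< (ℕ.s≤s⁻¹ c≤a) λ c≡a → c≢a′ (Fin.toℕ-injective (trans c≡a (sym (Fin.toℕ-fromℕ< a<K)))))
      ℕ.m≤n⇒m≤1+n)
    (sym (ℤ.+-identityˡ _))

available-∖ : ∀ {V : Row K} {a κ} → Available V a (1ℤ + κ) →
              ∀ c → toℕ c ℕ.< a → V c ≡ 1ℤ → Available (V ∖ c) a κ
available-∖ {V = V} {a} {κ} av c c<a Vc = record
  { binary = λ d → ∖-binary d
  ; above  = λ d a≤d → cong₂ _*_ (above av d a≤d)
      (cong (λ s → 1ℤ + -1ℤ * s) (𝟙-no (d Fin.≟ c) λ { refl → ℕ.<⇒≱ c<a a≤d }))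
  ; count  = begin
      sum (λ d → below a d * (V d * ¬𝟙 d c))
        ≡⟨ sum-cong-≗ (λ d → expand (below a d) (V d) (𝟙 (d Fin.≟ c))) ⟩
      sum (λ d → below a d * V d + -1ℤ * (𝟙 (d Fin.≟ c) * (below a d * V d)))
        ≡⟨ ∑-distrib-+ (λ d → below a d * V d) _ ⟩
      sum (λ d → below a d * V d) + sum (λ d → -1ℤ * (𝟙 (d Fin.≟ c) * (below a d * V d)))
        ≡⟨ cong₂ _+_ (count av) (trans
             (sym (*-distribˡ-sum -1ℤ (λ d → 𝟙 (d Fin.≟ c) * (below a d * V d))))
             (cong (-1ℤ *_) (trans (∑-𝟙 c (λ d → below a d * V d)) (cong₂ _*_ (𝟙-yes (toℕ c ℕ.<? a) c<a) Vc)))) ⟩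
      (1ℤ + κ) + -1ℤ
        ≡⟨ cancel κ ⟩
      κ ∎
  }
  where
  open ≡-Reasoning
  expand : ∀ b v i → b * (v * (1ℤ + -1ℤ * i)) ≡ b * v + -1ℤ * (i * (b * v))
  expand = solve-∀
  cancel : ∀ κ → (1ℤ + κ) + -1ℤ ≡ κ
  cancel = solve-∀
  ∖-binary : ∀ d → (V ∖ c) d ≡ 0ℤ ⊎ (V ∖ c) d ≡ 1ℤ
  ∖-binary d with d Fin.≟ c
  ... | yes _ = inj₁ (ℤ.*-zeroʳ (V d))
  ... | no  _ = subst (λ v → v ≡ 0ℤ ⊎ v ≡ 1ℤ) (sym (ℤ.*-identityʳ (V d))) (binary av d)

-- Each of the `1 + κ` admissible columns leads to the same state `κ`; nestedness of the later rows
-- is what makes a value `x` independent of the chosen column attainable.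
permanent-below : ∀ {V : Row K} {a x} As κ → Available V a (1ℤ + κ) →
                  (∀ V′ → Available V′ a κ → permanent As V′ ≡ x) →
                  permanent (below a ∷ As) V ≡ (1ℤ + κ) * x
permanent-below {V = V} {a} {x} As κ av As≡x = begin
  sum (λ c → (below a c * V c) * permanent As (V ∖ c)) ≡⟨ sum-cong-≗ term ⟩
  sum (λ c → (below a c * V c) * x)                    ≡⟨ *-distribʳ-sum x (λ c → below a c * V c) ⟨
  sum (λ c → below a c * V c) * x                      ≡⟨ cong (_* x) (count av) ⟩
  (1ℤ + κ) * x                                         ∎
  where
  open ≡-Reasoning
  term : ∀ c → (below a c * V c) * permanent As (V ∖ c) ≡ (below a c * V c) * x
  vanishing : ∀ c → below a c * V c ≡ 0ℤ →
              (below a c * V c) * permanent As (V ∖ c) ≡ (below a c * V c) * x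
  vanishing c eq = trans (cong (_* permanent As (V ∖ c)) eq) (sym (cong (_* x) eq))
  term c with toℕ c ℕ.<? a | binary av c
  ... | no  c≮a | _       = vanishing c (cong (_* V c) (𝟙-no (toℕ c ℕ.<? a) c≮a))
  ... | yes _   | inj₁ Vc = vanishing c (trans (cong (below a c *_) Vc) (ℤ.*-zeroʳ (below a c)))
  ... | yes c<a | inj₂ Vc = cong ((below a c * V c) *_) (As≡x (V ∖ c) (available-∖ av c c<a Vc))

fallingFactorial : ℕ → ℤ → ℤ
fallingFactorial zero    κ = 1ℤ
fallingFactorial (suc p) κ = κ * fallingFactorial p (-1ℤ + κ)

1+[-1+κ] : ∀ κ → 1ℤ + (-1ℤ + κ) ≡ κ
1+[-1+κ] = solve-∀

permanent-full : ∀ p {V : Row K} {κ} → Available V K κ →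
                 permanent (replicate p full) V ≡ fallingFactorial p κ
permanent-full zero    av = refl
permanent-full {K} (suc p) {V} {κ} av = begin
  permanent (full ∷ replicate p full) V
    -- An unrestricted row is `below K`.
    ≡⟨ permanent-head-cong (replicate p full) V (λ c → sym (𝟙-yes (toℕ c ℕ.<? K) (Fin.toℕ<n c))) ⟩
  permanent (below K ∷ replicate p full) V
    ≡⟨ permanent-below (replicate p full) (-1ℤ + κ) (subst (Available V K) (sym (1+[-1+κ] κ)) av)
         (λ V′ → permanent-full p {V′}) ⟩
  (1ℤ + (-1ℤ + κ)) * fallingFactorial p (-1ℤ + κ)
    ≡⟨ cong (_* fallingFactorial p (-1ℤ + κ)) (1+[-1+κ] κ) ⟩
  κ * fallingFactorial p (-1ℤ + κ) ∎
  where open ≡-Reasoning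

-- κ columns below the current row are available and p rows are postponed; an
-- odd row is either postponed or chosen below itself, with sign -1.
dumontWalk : ℕ → ℕ → ℤ → ℤ
dumontWalk zero    p κ = fallingFactorial p κ
dumontWalk (suc j) p κ = (1ℤ + κ) * dumontWalk j (suc p) (1ℤ + κ) + -1ℤ * (κ * (κ * dumontWalk j p κ))

DumontAt : ℕ → ℕ → Set
DumontAt a c = (2 ∣ suc a → c ℕ.< a) × (¬ 2 ∣ suc a → a ℕ.≤ c)

dumontAt? : ∀ a c → Dec (DumontAt a c)
dumontAt? a c = ((2 ∣? suc a) →-dec (c ℕ.<? a)) ×-dec (¬? (2 ∣? suc a) →-dec (a ℕ.≤? c))

dumontRow : ℕ → Row K
dumontRow a c = 𝟙 (dumontAt? a (toℕ c))

2∤1+ : ∀ {a} → 2 ∣ a → ¬ 2 ∣ suc a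
2∤1+ {a} 2∣a 2∣1+a with ∣⇒≤ (∣m+n∣m⇒∣n (subst (2 ∣_) (ℕ.+-comm 1 a) 2∣1+a) 2∣a)
... | s≤s ()

-- Parity here is that of the index `a`, which stands for the element `suc a`: even indices carry
-- the odd condition `a ≤ σ a`, odd indices the even one.
dumontRow-even : ∀ {a} → 2 ∣ a → ∀ (c : Fin K) → dumontRow a c ≡ 1ℤ + -1ℤ * below a c
dumontRow-even {a = a} 2∣a c with toℕ c ℕ.<? a
... | yes c<a = trans
  (𝟙-no (dumontAt? a (toℕ c)) λ (_ , odd) → ℕ.<⇒≱ c<a (odd (2∤1+ 2∣a)))
  (cong (λ s → 1ℤ + -1ℤ * s) (sym (𝟙-yes (toℕ c ℕ.<? a) c<a)))
... | no  c≮a = trans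
  (𝟙-yes (dumontAt? a (toℕ c)) ((λ 2∣1+a → contradiction 2∣1+a (2∤1+ 2∣a)) , λ _ → ℕ.≮⇒≥ c≮a))
  (cong (λ s → 1ℤ + -1ℤ * s) (sym (𝟙-no (toℕ c ℕ.<? a) c≮a)))

dumontRow-odd : ∀ {a} → 2 ∣ a → ∀ (c : Fin K) → dumontRow (suc a) c ≡ below (suc a) c
dumontRow-odd {a = a} 2∣a c = 𝟙-cong (dumontAt? (suc a) (toℕ c)) (toℕ c ℕ.<? suc a)
  (λ (even , _) → even 2∣2+a) (λ c≤a → (λ _ → c≤a) , λ 2∤ → contradiction 2∣2+a 2∤)
  where
  2∣2+a : 2 ∣ suc (suc a)
  2∣2+a = ∣m∣n⇒∣m+n ∣-refl 2∣a

-- One step of the walk treats rows `a` and `suc a`, each followed by the release of its own column.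
-- If row `a` is postponed, the available columns go from `κ` to `1 + κ`, row `suc a` takes one, and
-- they return to `1 + κ`. If row `a` takes one of `κ`, column `a` restores `κ`, and the same
-- happens at row `suc a`.
permanent-dumont : ∀ j {a p κ} (A : ℕ → Row K) {V} → 2 ∣ a → (∀ i → A i ≡ dumontRow (i ℕ.+ a)) →
                   a ℕ.+ j ℕ.* 2 ≡ K → Available V a κ →
                   permanent (applyUpTo A (j ℕ.* 2) ++ replicate p full) V ≡ dumontWalk j p κ
permanent-dumont zero {a} {p} A 2∣a A≡ a≡K av = permanent-full p
  (subst (λ a → Available _ a _) (trans (sym (ℕ.+-identityʳ a)) a≡K) av)
permanent-dumont {K} (suc j) {a} {p} {κ} A {V} 2∣a A≡ a+2j≡K av = begin
  permanent (A 0 ∷ A 1 ∷ As ++ fulls) V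
    ≡⟨ permanent-head-cong (A 1 ∷ As ++ fulls) V (λ c → trans (cong (λ r → r c) (A≡ 0)) (dumontRow-even 2∣a c)) ⟩
  permanent ((λ c → 1ℤ + -1ℤ * below a c) ∷ A 1 ∷ As ++ fulls) V
    ≡⟨ permanent-complement (below a) (A 1 ∷ As ++ fulls) V ⟩
  permanent (full ∷ A 1 ∷ As ++ fulls) V + -1ℤ * permanent (below a ∷ A 1 ∷ As ++ fulls) V
    ≡⟨ cong₂ (λ s t → s + -1ℤ * t) postponed
         (trans (permanent-below (A 1 ∷ As ++ fulls) (-1ℤ + κ) (subst (Available V a) (sym (1+[-1+κ] κ)) av) chosen)
                (cong (_* (κ * dumontWalk j p κ)) (1+[-1+κ] κ))) ⟩
  dumontWalk (suc j) p κ ∎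
  where
  open ≡-Reasoning
  As = applyUpTo (λ i → A (suc (suc i))) (j ℕ.* 2)
  fulls = replicate p full
  a+2+2j≡K : suc (suc a) ℕ.+ j ℕ.* 2 ≡ K
  a+2+2j≡K = trans (sym (trans (ℕ.+-suc a _) (cong suc (ℕ.+-suc a _)))) a+2j≡K
  1+a<K : suc a ℕ.< K
  1+a<K = subst (suc a ℕ.<_) a+2+2j≡K (ℕ.m≤m+n (suc (suc a)) (j ℕ.* 2))
  A-odd : ∀ c → A 1 c ≡ below (suc a) c
  A-odd c = trans (cong (λ r → r c) (A≡ 1)) (dumontRow-odd 2∣a c)
  rest : ∀ {V p κ} → Available V (suc (suc a)) κ → permanent (As ++ replicate p full) V ≡ dumontWalk j p κ
  rest = permanent-dumont j (λ i → A (suc (suc i))) (∣m∣n⇒∣m+n ∣-refl 2∣a)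
    (λ i → trans (A≡ (suc (suc i))) (cong dumontRow (sym (trans (ℕ.+-suc i _) (cong suc (ℕ.+-suc i _))))))
    a+2+2j≡K
  odd-row : ∀ p κ {V} → Available V (suc a) (1ℤ + κ) →
            permanent (A 1 ∷ As ++ replicate p full) V ≡ (1ℤ + κ) * dumontWalk j p (1ℤ + κ)
  odd-row p κ {V} av = trans (permanent-head-cong (As ++ replicate p full) V A-odd)
    (permanent-below (As ++ replicate p full) κ av λ V′ av′ → rest (available-suc 1+a<K av′))
  postponed : permanent (full ∷ A 1 ∷ As ++ fulls) V ≡ (1ℤ + κ) * dumontWalk j (suc p) (1ℤ + κ)
  postponed = trans (permanent-move full (A 1 ∷ As) fulls V)
    (odd-row (suc p) κ (available-suc (ℕ.<⇒≤ 1+a<K) av))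
  chosen : ∀ V′ → Available V′ a (-1ℤ + κ) → permanent (A 1 ∷ As ++ fulls) V′ ≡ κ * dumontWalk j p κ
  chosen V′ av′ = trans (odd-row p (-1ℤ + κ) (available-suc (ℕ.<⇒≤ 1+a<K) av′))
    (cong (λ s → s * dumontWalk j p s) (1+[-1+κ] κ))

-- Postponing raises `p` and `κ` together and the other branch changes neither, so a walk from
-- `p = κ = 0` stays on the diagonal. There `fallingFactorial k (+ k)` is `k!`, and the identity,
-- written without division, turns the walk into the Gandhi recursion.
dumontWalk-gandhi : ∀ j k → + suc k * dumontWalk j (suc k) (+ suc k) ≡
                            fallingFactorial k (+ k) * gandhi (suc j) (+ suc k)
dumontWalk-gandhi zero    k = base (+ suc k) (fallingFactorial k (+ k))
  where
  base : ∀ s f → s * (s * f) ≡ f * (s * s * ((1ℤ + s) + - s))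
  base = solve-∀
dumontWalk-gandhi (suc j) k = begin
  s * ((1ℤ + s) * W₂ + -1ℤ * (s * (s * W₁)))
    ≡⟨ cong₂ (λ u v → s * (u + -1ℤ * (s * v))) (dumontWalk-gandhi j (suc k)) (dumontWalk-gandhi j k) ⟩
  s * ((s * f) * g₂ + -1ℤ * (s * (f * g₁)))
    ≡⟨ regroup s f g₁ g₂ ⟩
  f * (s * s * (g₂ + - g₁)) ∎
  where
  open ≡-Reasoning
  s = + suc k
  f = fallingFactorial k (+ k)
  W₁ = dumontWalk j (suc k) (+ suc k)
  W₂ = dumontWalk j (suc (suc k)) (+ suc (suc k))
  g₁ = gandhi (suc j) (+ suc k)
  g₂ = gandhi (suc j) (+ suc (suc k))
  regroup : ∀ s f g h → s * ((s * f) * h + -1ℤ * (s * (f * g))) ≡ f * (s * s * (h + - g))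
  regroup = solve-∀

dumontWalk≡gandhi : ∀ m → dumontWalk m 0 0ℤ ≡ gandhi m 1ℤ
dumontWalk≡gandhi zero    = refl
dumontWalk≡gandhi (suc j) = begin
  -- No column lies below the first row, so only the postponed branch survives.
  1ℤ * dumontWalk j 1 1ℤ + 0ℤ ≡⟨ ℤ.+-identityʳ _ ⟩
  1ℤ * dumontWalk j 1 1ℤ      ≡⟨ dumontWalk-gandhi j 0 ⟩
  1ℤ * gandhi (suc j) 1ℤ      ≡⟨ ℤ.*-identityˡ _ ⟩
  gandhi (suc j) 1ℤ           ∎
  where open ≡-Reasoning

-- Counting functions by a permanent

sum-↑ : ∀ m (G : Fin (m ℕ.+ n) → ℤ) → sum G ≡ sum (λ i → G (i ↑ˡ n)) + sum (λ j → G (m ↑ʳ j))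
sum-↑ zero    G = sym (ℤ.+-identityˡ _)
sum-↑ (suc m) G = trans (cong (_+_ (G zero)) (sum-↑ m (G ∘ suc))) (sym (ℤ.+-assoc (G zero) _ _))

sum-combine : ∀ m (G : Fin (m ℕ.* n) → ℤ) → sum G ≡ sum {m} λ i → sum λ j → G (combine i j)
sum-combine     zero    G = refl
sum-combine {n} (suc m) G = trans (sum-↑ n G)
  (cong (_+_ (sum λ j → G (j ↑ˡ (m ℕ.* n)))) (sum-combine m λ i → G (n ↑ʳ i)))

-- The term of the permanent that belongs to the choice `σ`; its recursion follows the digits read
-- off by `finToFun`.
placement : ∀ n → (ℕ → Row K) → Row K → (Fin n → Fin K) → ℤ
placement zero    A V σ = 1ℤ
placement (suc n) A V σ =
  (A 0 (σ zero) * V (σ zero)) * placement n (A ∘ suc) (V ∖ σ zero) (λ i → σ (suc i))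

∑-placement : ∀ n (A : ℕ → Row K) V →
              sum {K ℕ.^ n} (λ x → placement n A V (finToFun x)) ≡ permanent (applyUpTo A n) V
∑-placement     zero    A V = refl
∑-placement {K} (suc n) A V = begin
  sum (λ x → term (remQuot (K ℕ.^ n) x))
    ≡⟨ sum-combine {K ℕ.^ n} K (λ x → term (remQuot (K ℕ.^ n) x)) ⟩
  sum {K} (λ c → sum {K ℕ.^ n} λ x → term (remQuot {K} (K ℕ.^ n) (combine {K} c x)))
    ≡⟨ sum-cong-≗ (λ c → sum-cong-≗ λ x → cong term (Fin.remQuot-combine c x)) ⟩
  sum (λ c → sum λ x → (A 0 c * V c) * placement n (A ∘ suc) (V ∖ c) (finToFun x))
    ≡⟨ sum-cong-≗ (λ c → *-distribˡ-sum (A 0 c * V c) (λ x → placement n (A ∘ suc) (V ∖ c) (finToFun x))) ⟨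
  sum (λ c → (A 0 c * V c) * sum λ x → placement n (A ∘ suc) (V ∖ c) (finToFun x))
    ≡⟨ sum-cong-≗ (λ c → cong ((A 0 c * V c) *_) (∑-placement n (A ∘ suc) (V ∖ c))) ⟩
  permanent (applyUpTo A (suc n)) V ∎
  where
  open ≡-Reasoning
  term : Fin K × Fin (K ℕ.^ n) → ℤ
  term (c , x) = (A 0 c * V c) * placement n (A ∘ suc) (V ∖ c) (finToFun x)

placement-one : ∀ n (A : ℕ → Row K) V σ → (∀ i → A (toℕ i) (σ i) ≡ 1ℤ) → (∀ i → V (σ i) ≡ 1ℤ) →
                Injective _≡_ _≡_ σ → placement n A V σ ≡ 1ℤ
placement-one zero    A V σ A≡1 V≡1 inj = refl
placement-one (suc n) A V σ A≡1 V≡1 inj = cong₂ _*_ (cong₂ _*_ (A≡1 zero) (V≡1 zero))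
  (placement-one n (A ∘ suc) (V ∖ σ zero) (λ i → σ (suc i)) (A≡1 ∘ suc)
    (λ i → cong₂ _*_ (V≡1 (suc i)) (cong (λ s → 1ℤ + -1ℤ * s)
      (𝟙-no (σ (suc i) Fin.≟ σ zero) λ eq → contradiction (inj eq) λ ())))
    (λ eq → Fin.suc-injective (inj eq)))

placement-zero-A : ∀ n (A : ℕ → Row K) V σ i → A (toℕ i) (σ i) ≡ 0ℤ → placement n A V σ ≡ 0ℤ
placement-zero-A (suc n) A V σ zero    A≡0 rewrite A≡0 = refl
placement-zero-A (suc n) A V σ (suc i) A≡0 = trans
  (cong ((A 0 (σ zero) * V (σ zero)) *_) (placement-zero-A n (A ∘ suc) (V ∖ σ zero) (λ i → σ (suc i)) i A≡0))
  (ℤ.*-zeroʳ (A 0 (σ zero) * V (σ zero)))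

placement-zero-V : ∀ n (A : ℕ → Row K) V σ i → V (σ i) ≡ 0ℤ → placement n A V σ ≡ 0ℤ
placement-zero-V (suc n) A V σ zero    V≡0 =
  cong (_* placement n (A ∘ suc) (V ∖ σ zero) (λ i → σ (suc i)))
    (trans (cong (A 0 (σ zero) *_) V≡0) (ℤ.*-zeroʳ (A 0 (σ zero))))
placement-zero-V (suc n) A V σ (suc i) V≡0 = trans
  (cong ((A 0 (σ zero) * V (σ zero)) *_) (placement-zero-V n (A ∘ suc) (V ∖ σ zero) (λ i → σ (suc i)) i
    (cong (_* ¬𝟙 (σ (suc i)) (σ zero)) V≡0)))
  (ℤ.*-zeroʳ (A 0 (σ zero) * V (σ zero)))

placement-collision : ∀ n (A : ℕ → Row K) V σ i j → i ≢ j → σ i ≡ σ j → placement n A V σ ≡ 0ℤ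
placement-collision (suc n) A V σ i j i≢j σi≡σj = trans
  (cong ((A 0 (σ zero) * V (σ zero)) *_) (tail≡0 i j i≢j σi≡σj)) (ℤ.*-zeroʳ (A 0 (σ zero) * V (σ zero)))
  where
  taken : ∀ i → σ (suc i) ≡ σ zero → placement n (A ∘ suc) (V ∖ σ zero) (λ i → σ (suc i)) ≡ 0ℤ
  taken i eq = placement-zero-V n (A ∘ suc) (V ∖ σ zero) (λ i → σ (suc i)) i
    (trans (cong (λ s → V (σ (suc i)) * (1ℤ + -1ℤ * s)) (𝟙-yes (σ (suc i) Fin.≟ σ zero) eq))
           (ℤ.*-zeroʳ (V (σ (suc i)))))
  tail≡0 : ∀ i j → i ≢ j → σ i ≡ σ j → placement n (A ∘ suc) (V ∖ σ zero) (λ i → σ (suc i)) ≡ 0ℤ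
  tail≡0 zero    zero    i≢j eq = contradiction refl i≢j
  tail≡0 zero    (suc j) i≢j eq = taken j (sym eq)
  tail≡0 (suc i) zero    i≢j eq = taken i eq
  tail≡0 (suc i) (suc j) i≢j eq =
    placement-collision n (A ∘ suc) (V ∖ σ zero) (λ i → σ (suc i)) i j (i≢j ∘ cong suc) eq

injective⇒surjective : ∀ {σ : Fin n → Fin n} → Injective _≡_ _≡_ σ → Surjective _≡_ _≡_ σ
injective⇒surjective {suc n} {σ} inj y with Fin.any? (λ x → σ x Fin.≟ y)
... | yes (x , σx≡y) = x , λ { refl → σx≡y }
... | no  y∉         = contradiction (Fin.injective⇒≤ out-injective) ℕ.1+n≰n
  where
  y≢σ : ∀ x → y ≢ σ x
  y≢σ x y≡σx = y∉ (x , sym y≡σx)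
  out-injective : Injective _≡_ _≡_ (λ x → Fin.punchOut (y≢σ x))
  out-injective {x} {x′} eq = inj (Fin.punchOut-injective (y≢σ x) (y≢σ x′) eq)

-- Some factor is 0 if a row condition fails or a column is used twice, and otherwise all are 1.
-- Surjectivity then follows from injectivity, by finiteness.
𝟙-isDumont : ∀ (σ : Fin n → Fin n) → 𝟙 (isDumont? σ) ≡ placement n dumontRow full σ
𝟙-isDumont {n} σ with Fin.all? (λ a → dumontAt? (toℕ a) (toℕ (σ a)))
... | no ¬dumont =
  let a , ¬at = Fin.¬∀⟶∃¬ n _ (λ a → dumontAt? (toℕ a) (toℕ (σ a))) ¬dumont
  in trans (𝟙-no (isDumont? σ) λ (mkDumont _ even odd) → ¬at (even a , odd a))
           (sym (placement-zero-A n dumontRow full σ a (𝟙-no (dumontAt? (toℕ a) (toℕ (σ a))) ¬at)))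
... | yes dumont with Fin.any? (λ a → Fin.any? λ b → ¬? (a Fin.≟ b) ×-dec (σ a Fin.≟ σ b))
...   | yes (a , b , a≢b , σa≡σb) =
  trans (𝟙-no (isDumont? σ) λ (mkDumont (inj , _) _ _) → a≢b (inj σa≡σb))
        (sym (placement-collision n dumontRow full σ a b a≢b σa≡σb))
...   | no ¬collision =
  trans (𝟙-yes (isDumont? σ) (mkDumont (inj , injective⇒surjective inj) (proj₁ ∘ dumont) (proj₂ ∘ dumont)))
        (sym (placement-one n dumontRow full σ
          (λ a → 𝟙-yes (dumontAt? (toℕ a) (toℕ (σ a))) (dumont a)) (λ _ → refl) inj))
  where
  inj : Injective _≡_ _≡_ σ
  inj {a} {b} σa≡σb with a Fin.≟ b
  ... | yes a≡b = a≡b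
  ... | no  a≢b = contradiction (a , b , a≢b , σa≡σb) ¬collision

length-filter : ∀ {A : Set} {P : Pred A 0ℓ} (P? : ∀ x → Dec (P x)) xs →
                + length (filter P? xs) ≡ ∑ᴸ xs (λ x → 𝟙 (P? x))
length-filter P? []       = refl
length-filter P? (x ∷ xs) with P? x
... | yes _ = cong (_+_ 1ℤ) (length-filter P? xs)
... | no  _ = trans (length-filter P? xs) (sym (ℤ.+-identityˡ _))

∑ᴸ-tabulate : ∀ {A : Set} (g : Fin n → A) (f : A → ℤ) → ∑ᴸ (tabulate g) f ≡ sum (λ i → f (g i))
∑ᴸ-tabulate {zero}  g f = refl
∑ᴸ-tabulate {suc n} g f = cong (_+_ (f (g zero))) (∑ᴸ-tabulate (g ∘ suc) f)

#Dumont-permanent : ∀ K → + #Dumont K ≡ permanent (applyUpTo (dumontRow {K}) K) full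
#Dumont-permanent K = begin
  + #Dumont K
    ≡⟨ length-filter isDumont? (map (finToFun {K} {K}) (allFin (K ℕ.^ K))) ⟩
  ∑ᴸ (map (finToFun {K} {K}) (allFin (K ℕ.^ K))) (λ σ → 𝟙 (isDumont? σ))
    ≡⟨ ∑ᴸ-map (finToFun {K} {K}) (allFin (K ℕ.^ K)) (λ σ → 𝟙 (isDumont? σ)) ⟩
  ∑ᴸ (allFin (K ℕ.^ K)) (λ x → 𝟙 (isDumont? (finToFun {K} {K} x)))
    ≡⟨ ∑ᴸ-tabulate id (λ x → 𝟙 (isDumont? (finToFun {K} {K} x))) ⟩
  sum (λ x → 𝟙 (isDumont? (finToFun {K} {K} x)))
    ≡⟨ sum-cong-≗ (λ x → 𝟙-isDumont (finToFun {K} {K} x)) ⟩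
  sum (λ x → placement K dumontRow full (finToFun {K} {K} x))
    ≡⟨ ∑-placement K dumontRow full ⟩
  permanent (applyUpTo dumontRow K) full ∎
  where open ≡-Reasoning

#Dumont≡gandhi : ∀ m → + #Dumont (m ℕ.* 2) ≡ gandhi m 1ℤ
#Dumont≡gandhi m = begin
  + #Dumont 2m                              ≡⟨ #Dumont-permanent 2m ⟩
  permanent (applyUpTo dumontRow 2m) full   ≡⟨ cong (λ As → permanent As full) (List.++-identityʳ (applyUpTo dumontRow 2m)) ⟨
  permanent (applyUpTo dumontRow 2m ++ []) full
    ≡⟨ permanent-dumont m dumontRow (2 ∣0) (λ i → cong dumontRow (sym (ℕ.+-identityʳ i))) refl start ⟩
  dumontWalk m 0 0ℤ                        ≡⟨ dumontWalk≡gandhi m ⟩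
  gandhi m 1ℤ                              ∎
  where
  open ≡-Reasoning
  2m = m ℕ.* 2
  start : Available {2m} full 0 0ℤ
  start = record
    { binary = λ _ → inj₂ refl
    ; above  = λ _ _ → refl
    ; count  = ∑-zero {2m} (λ c → below 0 c * 1ℤ) λ _ → refl
    }

corollary3p9 : (n : ℕ) → n ≥ 1 → let open Linial n in
    ∃ (IsMöbius lattice) ×
    (∀ μ → IsMöbius lattice μ → μ 0̂ 1̂ ≡ - (+ genocchi n))
corollary3p9 (suc m) _ = (μ , μ-isMöbius) , λ ν isMöbius → begin
  ν 0̂ 1̂                    ≡⟨ μ-unique isMöbius {0̂} {1̂} (λ {p} → 1̂-maximum 0̂ {p}) ⟩
  μ 0̂ 1̂                    ≡⟨ linial-μ m ⟩
  - gandhi m 1ℤ            ≡⟨ cong -_ (#Dumont≡gandhi m) ⟨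
  -- `suc m * 2` computes to `2 + m * 2`, from which `∸ 2` leaves `m * 2`.
  - (+ #Dumont (m ℕ.* 2))  ≡⟨ cong (λ k → - (+ #Dumont (k ℕ.∸ 2))) (ℕ.*-comm (suc m) 2) ⟩
  - (+ genocchi (suc m))   ∎
  where
  open ≡-Reasoning
  open Linial (suc m)
  open LinialMöbius (suc m)
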